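{- Let $G$ be a graph. Then every connected induced subgraph of $G$ is dominated by an induced connected split graph (that is, for every connected induced subgraph $F$ of $G$ there is a dominating set $D$ of $F$ such that the induced subgraph $F[D]$ is a connected split graph) if and only if $G$ is $\mathcal{C}$-free, where $\mathcal{C}=\{P_7,C_7,Q_1,Q_2,Q_3,Q_4\}$.
   Context: All graphs are finite and simple. $P_\ell$ and $C_\ell$ denote the chordless path and the chordless cycle on $\ell$ vertices. For a set $\mathcal{L}$ of graphs, a graph is $\mathcal{L}$-free if it contains no induced subgraph isomorphic to a member of $\mathcal{L}$. A set $D\subseteq V(F)$ is a dominating set of a graph $F$ if every vertex of $V(F)\setminus D$ is adjacent to some vertex of $D$. A split graph is a graph whose vertex set can be partitioned into a stable set and a clique (either part may be empty). Attaching a leaf to a vertex $u$ of a graph means adding a new vertex $u'$ and the single edge $uu'$. The graphs $Q_1,\dots,Q_4$ are defined as follows. $Q_1$: the graph obtained from $C_5$ by attaching one leaf to each of its five vertices. $Q_2$: the graph obtained from $C_4$ by attaching one leaf to each of its four vertices. $H_1$: the graph with vertices $a,b,c,d,e$ and edges $ab,bc,ca,ad,de$. $Q_3$ is the graph obtained from $H_1$ by attaching one leaf to each of its non-cut vertices $b,c,e$. $H_2$: the graph with vertices $a,b,c,d,e$ and edges $ab,bc,ca,ad,de,ae$. $Q_4$ is the graph obtained from $H_2$ by attaching one leaf to each of its non-cut vertices $b,c,d,e$. -}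

module Defs where

open import Data.Bool using (Bool; T)
open import Data.Empty using (⊥)
open import Data.Fin using (Fin; toℕ; _≟_)
open import Data.Fin.Patterns using (0F; 1F; 2F; 3F; 4F)
open import Data.List using (List; []; _∷_)
open import Data.List.Relation.Unary.All using (All)
import Data.List.Membership.DecPropositional as DecMembership
open import Data.Nat as ℕ using (ℕ; suc; NonZero)
open import Data.Nat.DivMod using (_%_)
open import Data.Product using (Σ; ∃; _×_; _,_; proj₁; proj₂)
open import Data.Product.Properties using (≡-dec)
open import Data.Sum using (_⊎_; inj₁; inj₂; swap)
open import Data.Vec using (Vec; []; _∷_; lookup; allFin)
open import Function.Base using (_∘_)
open import Function.Bundles using (_↔_; _⇔_; module Inverse)
open import Level using (0ℓ)
open import Relation.Binary.Core using (Rel)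
open import Relation.Binary.Construct.Closure.ReflexiveTransitive using (Star)
open import Relation.Binary.Definitions
  using (Symmetric; Irreflexive; Decidable; DecidableEquality)
open import Relation.Binary.PropositionalEquality using (_≡_; _≢_; refl; sym)
open import Relation.Nullary using (¬_; no)
open import Relation.Nullary.Decidable using (¬?; _×-dec_; _⊎-dec_)

-- Simple graphs with decidable adjacency.  Finiteness is imposed by the vertex
-- type: a finite graph is a `Graph (Fin n)`, and its induced subgraphs live on
-- (decidable) subtypes of `Fin n`.

record Graph (V : Set) : Set₁ where
  infix 4 _∼_ _∼?_
  field
    _∼_      : Rel V 0ℓ
    _∼?_     : Decidable _∼_
    ∼-sym    : Symmetric _∼_
    ∼-irrefl : Irreflexive _≡_ _∼_

VertexSet : Set → Set
VertexSet V = V → Bool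

infix 4 _∈_ _∉_

_∈_ _∉_ : {V : Set} → V → VertexSet V → Set
v ∈ S = T (S v)
v ∉ S = ¬ v ∈ S

-- `v ∈ S` has at most one proof, so no vertex is duplicated here.

_[_] : {V : Set} → Graph V → (S : VertexSet V) → Graph (∃ λ v → v ∈ S)
G [ S ] = record
  { _∼_      = λ u v → proj₁ u ∼ proj₁ v
  ; _∼?_     = λ u v → proj₁ u ∼? proj₁ v
  ; ∼-sym    = ∼-sym
  ; ∼-irrefl = λ { refl → ∼-irrefl refl }
  } where open Graph G

record _≅_ {V W : Set} (G : Graph V) (H : Graph W) : Set where
  private
    module G = Graph G
    module H = Graph H
  field
    vertices : V ↔ W
  open Inverse vertices using (to)
  field
    adjacency : ∀ u v → (u G.∼ v) ⇔ (to u H.∼ to v)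

_-free_ : List (Σ Set Graph) → {V : Set} → Graph V → Set₁
𝓛 -free G = All (λ H → ¬ (∃ λ S → (G [ S ]) ≅ proj₂ H)) 𝓛

module _ {V : Set} (G : Graph V) where
  open Graph G

  -- The graph with no vertices is not regarded as connected.
  Connected : Set
  Connected = V × (∀ u v → Star _∼_ u v)

  Dominating : VertexSet V → Set
  Dominating D = ∀ v → v ∉ D → ∃ λ u → u ∈ D × v ∼ u

  Clique : VertexSet V → Set
  Clique K = ∀ u v → u ∈ K → v ∈ K → u ≢ v → u ∼ v

  -- The stable part of the partition is the complement of the clique K.
  Split : Set
  Split = ∃ λ K → Clique K × (∀ u v → u ∉ K → v ∉ K → ¬ u ∼ v)

-- The simple graph obtained from a relation by symmetrising and dropping loops.

fromRel : {V : Set} → DecidableEquality V →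
          {R : Rel V 0ℓ} → Decidable R → Graph V
fromRel _≟ⱽ_ {R} R? = record
  { _∼_      = λ u v → u ≢ v × (R u v ⊎ R v u)
  ; _∼?_     = λ u v → ¬? (u ≟ⱽ v) ×-dec (R? u v ⊎-dec R? v u)
  ; ∼-sym    = λ (u≢v , r) → u≢v ∘ sym , swap r
  ; ∼-irrefl = λ u≡v (u≢v , _) → u≢v u≡v
  }

fromEdges : ∀ {n} → List (Fin n × Fin n) → Graph (Fin n)
fromEdges es = fromRel _≟_ (λ u v → (u , v) ∈? es)
  where open DecMembership (≡-dec _≟_ _≟_) using (_∈?_)

P : ∀ ℓ → Graph (Fin ℓ)
P ℓ = fromRel _≟_ (λ i j → toℕ j ℕ.≟ suc (toℕ i))

-- The cycle on ℓ vertices when ℓ ≥ 3.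
C : ∀ ℓ .{{_ : NonZero ℓ}} → Graph (Fin ℓ)
C ℓ = fromRel _≟_ (λ i j → toℕ j ℕ.≟ suc (toℕ i) % ℓ)

-- For each index i, a new vertex `inj₂ i` adjacent only to `lookup us i`.

attachLeaves : ∀ {n k} → Graph (Fin n) → Vec (Fin n) k → Graph (Fin n ⊎ Fin k)
attachLeaves {n} {k} G us = record
  { _∼_      = _≈_
  ; _∼?_     = _≈?_
  ; ∼-sym    = λ {x} {y} → ≈-sym x y
  ; ∼-irrefl = λ {x} → λ { refl → ≈-irrefl x }
  }
  where
  open Graph G

  _≈_ : Rel (Fin n ⊎ Fin k) 0ℓ
  inj₁ u ≈ inj₁ v = u ∼ v
  inj₁ u ≈ inj₂ i = u ≡ lookup us i
  inj₂ i ≈ inj₁ u = u ≡ lookup us i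
  inj₂ _ ≈ inj₂ _ = ⊥

  _≈?_ : Decidable _≈_
  inj₁ u ≈? inj₁ v = u ∼? v
  inj₁ u ≈? inj₂ i = u ≟ lookup us i
  inj₂ i ≈? inj₁ u = u ≟ lookup us i
  inj₂ _ ≈? inj₂ _ = no λ ()

  ≈-sym : ∀ x y → x ≈ y → y ≈ x
  ≈-sym (inj₁ _) (inj₁ _) e = ∼-sym e
  ≈-sym (inj₁ _) (inj₂ _) e = e
  ≈-sym (inj₂ _) (inj₁ _) e = e

  ≈-irrefl : ∀ x → ¬ (x ≈ x)
  ≈-irrefl (inj₁ _) e = ∼-irrefl refl e

Q₁ : Graph (Fin 5 ⊎ Fin 5)
Q₁ = attachLeaves (C 5) (allFin 5)

Q₂ : Graph (Fin 4 ⊎ Fin 4)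
Q₂ = attachLeaves (C 4) (allFin 4)

private
  pattern a = 0F
  pattern b = 1F
  pattern c = 2F
  pattern d = 3F
  pattern e = 4F

H₁ H₂ : Graph (Fin 5)
H₁ = fromEdges ((a , b) ∷ (b , c) ∷ (c , a) ∷ (a , d) ∷ (d , e) ∷ [])
H₂ = fromEdges ((a , b) ∷ (b , c) ∷ (c , a) ∷ (a , d) ∷ (d , e) ∷ (a , e) ∷ [])

Q₃ : Graph (Fin 5 ⊎ Fin 3)
Q₃ = attachLeaves H₁ (b ∷ c ∷ e ∷ [])

Q₄ : Graph (Fin 5 ⊎ Fin 4)
Q₄ = attachLeaves H₂ (b ∷ c ∷ d ∷ e ∷ [])

𝓒 : List (Σ Set Graph)
𝓒 = (_ , P 7) ∷ (_ , C 7) ∷ (_ , Q₁) ∷ (_ , Q₂) ∷ (_ , Q₃) ∷ (_ , Q₄) ∷ []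

{-# OPTIONS --safe #-}

-- A connected split dominating set of P₇, C₇ or some Qᵢ would contain an induced 2K₂, C₄ or C₅:
-- in Qᵢ it has to contain every vertex that carries a leaf, in P₇ all inner vertices, and in C₇
-- five consecutive vertices.
--
-- Conversely, induct on the size of a connected set S in a 𝓒-free graph.  If v is not a cut vertex
-- of S, then S ∖ v has a connected split dominating set D, and we are done unless D avoids v and all
-- its neighbours.  In that case no neighbour of v is a cut vertex of S, except if v is pendant.  Hence
-- either all non-cut vertices are pendant, or there are no cut vertices at all.
--
-- In the first case the cut vertices form a connected dominating set X.  Every x ∈ X has, in each
-- component of S ∖ x, a neighbour that can serve as a leaf, and such leaves are pairwise non-adjacent.
-- So P₅, C₄, C₅, H₁ or H₂ inside X would give P₇ or some Qᵢ, and X is split by Földes and Hammer.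
--
-- In the second case take an edge vu and apply induction to S without the neighbours of v other than
-- u.  Adding v to the resulting set gives a connected dominating set D in which v is pendant at u and
-- the other neighbours of u form a clique, while v has a private neighbour w.  Such a D is shrunk as
-- long as it is not split: an edge far from u closes an induced P₅ or H₁ with uv, and since the leaves
-- at that edge do not give P₇, C₇ or Q₃, they are all adjacent to w.  Then w can replace both ends of
-- the edge, and w v takes over the role of v u.

module Submission where

open import Data.Bool using (true; false; T; _∧_; _∨_; not; if_then_else_)
open import Data.Bool.Properties using (∧-identityʳ; ∨-identityʳ; T?; T-irrelevant)
open import Data.Empty using (⊥; ⊥-elim)
open import Data.Fin using (Fin; zero; suc; _≟_; toℕ)
import Data.Fin as Fin
open import Data.Fin.Patterns using (0F; 1F; 2F; 3F; 4F; 5F; 6F)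
open import Data.Fin.Properties using (any?; all?; toℕ-injective)
import Data.Fin.Properties as Fin
open import Data.List using (List; []; _∷_)
import Data.List.Membership.DecPropositional as DecMembership
open import Data.List.Membership.Propositional using () renaming (_∈_ to _∈ˡ_)
open import Data.List.Relation.Unary.All as All using (All; []; _∷_)
open import Data.List.Relation.Unary.Any using (here; there)
open import Data.List.Relation.Unary.Linked using (Linked; linked?; [-]; _∷_)
open import Data.Nat using (ℕ; zero; suc; _+_; _*_; _∸_; _≤_; _<_; z≤n; s≤s)
open import Data.Nat.DivMod using (_mod_)
open import Data.Nat.Induction using (<-wellFounded)
import Data.Nat.Properties as ℕ
open import Data.Nat.Solver using (module +-*-Solver)
open import Data.Product using (∃; ∃₂; _×_; _,_; proj₁; proj₂)
open import Data.Sum using (_⊎_; inj₁; inj₂; [_,_]′)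
import Data.Sum.Properties as Sum
open import Data.Unit using (⊤; tt)
open import Data.Vec using (Vec; []; _∷_; lookup; allFin)
open import Function.Base using (_∘_; id; case_of_)
open import Function.Bundles using (_⇔_; mk⇔; mk↔ₛ′; Equivalence; Inverse)
open import Induction.WellFounded using (Acc; acc)
open import Relation.Binary.Construct.Closure.ReflexiveTransitive using (Star; ε; _◅_; _◅◅_; reverse; gmap)
open import Relation.Binary.Definitions using (DecidableEquality)
open import Relation.Binary.PropositionalEquality
  using (_≡_; _≢_; refl; sym; trans; cong; cong₂; subst; subst₂; module ≡-Reasoning)
open import Relation.Nullary using (¬_; Dec; yes; no; does; contradiction)
open import Relation.Nullary.Decidable
  using (¬?; _×-dec_; _⊎-dec_; _→-dec_; map′; dec-true; dec-false; decidable-stable; from-yes; from-no)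
open import Relation.Unary using (Decidable)
open import Defs

-- Vertex sets and their weights

infix 4 _∈?_ _⊆_

_∈?_ : {V : Set} (v : V) (S : VertexSet V) → Dec (v ∈ S)
v ∈? S = T? (S v)

_⊆_ : {V : Set} → VertexSet V → VertexSet V → Set
S ⊆ S′ = ∀ v → v ∈ S → v ∈ S′

-- Opaque, so that a with-abstraction over a decision does not reach into memberships.
opaque
  ⟪_⟫ : {V : Set} {P : V → Set} → Decidable P → VertexSet V
  ⟪ P? ⟫ v = does (P? v)

module _ {V : Set} {P : V → Set} (P? : Decidable P) {v : V} where

  opaque
    unfolding ⟪_⟫

    ⟪⟫⁺ : P v → v ∈ ⟪ P? ⟫
    ⟪⟫⁺ p = subst T (sym (dec-true (P? v) p)) tt

    ⟪⟫⁻ : v ∈ ⟪ P? ⟫ → P v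
    ⟪⟫⁻ v∈P with P? v
    ... | yes p = p

none⇒all : ∀ {n} {P : Fin n → Set} → Decidable P → ¬ (∃ λ v → ¬ P v) → ∀ v → P v
none⇒all P? none v = decidable-stable (P? v) λ ¬p → none (v , ¬p)

module _ {n : ℕ} where

  infixl 7 _⊕_ _⊖_

  opaque
    _⊕_ _⊖_ : VertexSet (Fin n) → Fin n → VertexSet (Fin n)
    S ⊕ x = ⟪ (λ v → (v ∈? S) ⊎-dec (v ≟ x)) ⟫
    S ⊖ x = ⟪ (λ v → (v ∈? S) ×-dec ¬? (v ≟ x)) ⟫

  module _ (S : VertexSet (Fin n)) (x : Fin n) where

    opaque
      unfolding _⊕_

      ∈-⊕⁻ : ∀ {v} → v ∈ S ⊕ x → v ∈ S ⊎ v ≡ x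
      ∈-⊕⁻ = ⟪⟫⁻ (λ v → (v ∈? S) ⊎-dec (v ≟ x))

      ∈-⊕⁺ : ∀ {v} → v ∈ S → v ∈ S ⊕ x
      ∈-⊕⁺ v∈S = ⟪⟫⁺ (λ v → (v ∈? S) ⊎-dec (v ≟ x)) (inj₁ v∈S)

      x∈S⊕x : x ∈ S ⊕ x
      x∈S⊕x = ⟪⟫⁺ (λ v → (v ∈? S) ⊎-dec (v ≟ x)) (inj₂ refl)

      ∈-⊖⁻ : ∀ {v} → v ∈ S ⊖ x → v ∈ S × v ≢ x
      ∈-⊖⁻ = ⟪⟫⁻ (λ v → (v ∈? S) ×-dec ¬? (v ≟ x))

      ∈-⊖⁺ : ∀ {v} → v ∈ S → v ≢ x → v ∈ S ⊖ x
      ∈-⊖⁺ v∈S v≢x = ⟪⟫⁺ (λ v → (v ∈? S) ×-dec ¬? (v ≟ x)) (v∈S , v≢x)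

-- Size is the case of constant weight 1. The clique search behind the Földes-Hammer theorem needs a
-- weight that also counts degrees.
weight : ∀ {n} → (Fin n → ℕ) → VertexSet (Fin n) → ℕ
weight {zero}  f S = 0
weight {suc n} f S = (if S zero then f zero else 0) + weight (f ∘ suc) (S ∘ suc)

∣_∣ : ∀ {n} → VertexSet (Fin n) → ℕ
∣_∣ = weight λ _ → 1

weight-cong : ∀ {n} (f : Fin n → ℕ) {S S′ : VertexSet (Fin n)} →
              (∀ v → S v ≡ S′ v) → weight f S ≡ weight f S′
weight-cong {zero}  f S≗S′ = refl
weight-cong {suc n} f S≗S′ =
  cong₂ (λ b w → (if b then f zero else 0) + w) (S≗S′ zero) (weight-cong (f ∘ suc) (S≗S′ ∘ suc))

weight-mono : ∀ {n} (f : Fin n → ℕ) {S S′ : VertexSet (Fin n)} →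
              S ⊆ S′ → weight f S ≤ weight f S′
weight-mono {zero}  f S⊆S′ = z≤n
weight-mono {suc n} f {S} {S′} S⊆S′ with S zero | S′ zero | S⊆S′ zero
... | true  | true  | _ = ℕ.+-monoʳ-≤ (f zero) (weight-mono (f ∘ suc) (S⊆S′ ∘ suc))
... | true  | false | h = contradiction (h tt) λ ()
... | false | true  | _ = ℕ.≤-trans (weight-mono (f ∘ suc) (S⊆S′ ∘ suc)) (ℕ.m≤n+m _ (f zero))
... | false | false | _ = weight-mono (f ∘ suc) (S⊆S′ ∘ suc)

-- Phrased through agreement away from `x`, so that it serves the pair `S`, `S ⊕ x` and the pair
-- `S ⊖ x`, `S` alike.
weight-insert : ∀ {n} (f : Fin n → ℕ) {S S′ : VertexSet (Fin n)} x →
                (∀ v → v ≢ x → S v ≡ S′ v) → x ∉ S → x ∈ S′ →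
                weight f S′ ≡ f x + weight f S
weight-insert {suc n} f {S} {S′} zero S≗S′ x∉S x∈S′ with S zero | S′ zero
... | true  | _     = contradiction tt x∉S
... | false | false = contradiction x∈S′ λ ()
... | false | true  = cong (f zero +_) (weight-cong (f ∘ suc) λ v → sym (S≗S′ (suc v) λ ()))
weight-insert {suc n} f {S} {S′} (suc x) S≗S′ x∉S x∈S′ = begin
  c S′ + weight (f ∘ suc) (S′ ∘ suc)              ≡⟨ cong (c S′ +_) rec ⟩
  c S′ + (f (suc x) + weight (f ∘ suc) (S ∘ suc)) ≡⟨ ℕ.+-comm (c S′) _ ⟩
  f (suc x) + weight (f ∘ suc) (S ∘ suc) + c S′   ≡⟨ ℕ.+-assoc (f (suc x)) _ _ ⟩
  f (suc x) + (weight (f ∘ suc) (S ∘ suc) + c S′) ≡⟨ cong (f (suc x) +_) (ℕ.+-comm _ (c S′)) ⟩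
  f (suc x) + (c S′ + weight (f ∘ suc) (S ∘ suc)) ≡⟨ cong (λ k → f (suc x) + (k + _)) c≡ ⟨
  f (suc x) + (c S + weight (f ∘ suc) (S ∘ suc))  ∎
  where
  open ≡-Reasoning
  c : VertexSet (Fin (suc n)) → ℕ
  c A = if A zero then f zero else 0
  c≡ : c S ≡ c S′
  c≡ = cong (λ b → if b then f zero else 0) (S≗S′ zero λ ())
  rec = weight-insert (f ∘ suc) x (λ v v≢x → S≗S′ (suc v) (v≢x ∘ Fin.suc-injective)) x∉S x∈S′

module _ {n : ℕ} (f : Fin n → ℕ) (S : VertexSet (Fin n)) {x : Fin n} where

  opaque
    unfolding _⊕_ ⟪_⟫

    weight-⊕ : x ∉ S → weight f (S ⊕ x) ≡ f x + weight f S
    weight-⊕ x∉S = weight-insert f x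
      (λ v v≢x → sym (trans (cong (S v ∨_) (dec-false (v ≟ x) v≢x)) (∨-identityʳ (S v))))
      x∉S (x∈S⊕x S x)

    weight-⊖ : x ∈ S → weight f S ≡ f x + weight f (S ⊖ x)
    weight-⊖ x∈S = weight-insert f x
      (λ v v≢x → trans (cong (λ b → S v ∧ not b) (dec-false (v ≟ x) v≢x)) (∧-identityʳ (S v)))
      (λ x∈S⊖x → proj₂ (∈-⊖⁻ S x x∈S⊖x) refl) x∈S

module _ {n : ℕ} (S : VertexSet (Fin n)) where

  ∣⊖∣< : ∀ {x} → x ∈ S → ∣ S ⊖ x ∣ < ∣ S ∣
  ∣⊖∣< x∈S = ℕ.≤-reflexive (sym (weight-⊖ (λ _ → 1) S x∈S))

  ∣∣-mono-< : ∀ {S′ : VertexSet (Fin n)} {x} → S′ ⊆ S → x ∉ S′ → x ∈ S → ∣ S′ ∣ < ∣ S ∣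
  ∣∣-mono-< {S′} {x} S′⊆S x∉S′ x∈S = ℕ.≤-<-trans
    (weight-mono (λ _ → 1) λ v v∈S′ → ∈-⊖⁺ S x (S′⊆S v v∈S′) λ { refl → x∉S′ v∈S′ })
    (∣⊖∣< x∈S)

  ∣∣≤n : ∣ S ∣ ≤ n
  ∣∣≤n = bound S
    where
    bound : ∀ {m} (S : VertexSet (Fin m)) → ∣ S ∣ ≤ m
    bound {zero}  S = z≤n
    bound {suc m} S with S zero
    ... | true  = s≤s (bound (S ∘ suc))
    ... | false = ℕ.m≤n⇒m≤1+n (bound (S ∘ suc))

-- Connectedness and domination

module Domination {n : ℕ} (G : Graph (Fin n)) where
  open Graph G

  ∼⇒≢ : ∀ {x y} → x ∼ y → x ≢ y
  ∼⇒≢ x∼y x≡y = ∼-irrefl x≡y x∼y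

  ≁-sym : ∀ {x y} → ¬ x ∼ y → ¬ y ∼ x
  ≁-sym x≁y = x≁y ∘ ∼-sym

  Edge : VertexSet (Fin n) → Fin n → Fin n → Set
  Edge A x y = x ∈ A × y ∈ A × x ∼ y

  -- Vertices stay in `Fin n` rather than in a subtype, so a walk passes to a larger set with its
  -- vertices unchanged. The empty walk carries no membership proof.
  Walk : VertexSet (Fin n) → Fin n → Fin n → Set
  Walk A = Star (Edge A)

  Conn : VertexSet (Fin n) → Set
  Conn A = (∃ λ x → x ∈ A) × (∀ x y → x ∈ A → y ∈ A → Walk A x y)

  private variable
    A B : VertexSet (Fin n)
    x y z : Fin n

  walk-sym : Walk A x y → Walk A y x
  walk-sym = reverse λ (x∈A , y∈A , x∼y) → y∈A , x∈A , ∼-sym x∼y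

  walk-mono : A ⊆ B → Walk A x y → Walk B x y
  walk-mono A⊆B = gmap id λ (x∈A , y∈A , x∼y) → A⊆B _ x∈A , A⊆B _ y∈A , x∼y

  conn-hub : x ∈ A → (∀ y → y ∈ A → Walk A x y) → Conn A
  conn-hub x∈A walk = (_ , x∈A) , λ y z y∈A z∈A → walk-sym (walk y y∈A) ◅◅ walk z z∈A

  walk-invariant : (P : Fin n → Set) → (∀ {y z} → P y → Edge A y z → P z) →
                   P x → Walk A x y → P y
  walk-invariant P step px ε       = px
  walk-invariant P step px (e ◅ w) = walk-invariant P step (step px e) w

  crossing : {P : Fin n → Set} → Decidable P → Walk A x y → P x → ¬ P y →
             ∃₂ λ p q → P p × ¬ P q × Edge A p q
  crossing P? ε px ¬px = contradiction px ¬px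
  crossing P? (_◅_ {j = z} e w) px ¬py with P? z
  ... | yes pz = crossing P? w pz ¬py
  ... | no ¬pz = _ , _ , px , ¬pz , e

  neighbour : Conn A → x ∈ A → y ∈ A → y ≢ x → ∃ λ z → z ∈ A × x ∼ z
  neighbour {x = x} (_ , walk) x∈A y∈A y≢x
    with crossing (_≟ x) (walk _ _ x∈A y∈A) refl y≢x
  ... | _ , z , refl , _ , _ , z∈A , x∼z = z , z∈A , x∼z

  record Component (A : VertexSet (Fin n)) (x : Fin n) : Set where
    field
      region   : VertexSet (Fin n)
      root     : x ∈ region
      region⊆A : region ⊆ A
      reach    : ∀ y → y ∈ region → Walk A x y
      closed   : ∀ {y z} → y ∈ region → z ∈ A → y ∼ z → z ∈ region

  opaque
    component : ∀ A → x ∈ A → Component A x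
    component {x} A x∈A =
      grow ⟪ _≟ x ⟫ (⟪⟫⁺ (_≟ x) refl) (λ y y∈region → subst (_∈ A) (sym (⟪⟫⁻ (_≟ x) y∈region)) x∈A)
        (λ y y∈region → subst (Walk A x) (sym (⟪⟫⁻ (_≟ x) y∈region)) ε) (<-wellFounded _)
      where
      grow : (region : VertexSet (Fin n)) → x ∈ region → region ⊆ A → (∀ y → y ∈ region → Walk A x y) →
             Acc _<_ (n ∸ ∣ region ∣) → Component A x
      grow region x∈region region⊆A reach (acc rec)
        with any? (λ y → any? λ z →
               (y ∈? region) ×-dec (z ∈? A) ×-dec (y ∼? z) ×-dec ¬? (z ∈? region))
      ... | no none = record
        { region = region ; root = x∈region ; region⊆A = region⊆A ; reach = reach
        ; closed = λ {y} {z} y∈region z∈A y∼z → decidable-stable (z ∈? region) λ z∉region →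
                     none (y , z , y∈region , z∈A , y∼z , z∉region)
        }
      ... | yes (y , z , y∈region , z∈A , y∼z , z∉region) = grow (region ⊕ z) (∈-⊕⁺ region z x∈region)
        (λ v → [ region⊆A v , (λ { refl → z∈A }) ]′ ∘ ∈-⊕⁻ region z)
        (λ v → [ reach v , (λ { refl → reach y y∈region ◅◅ (region⊆A y y∈region , z∈A , y∼z) ◅ ε }) ]′ ∘ ∈-⊕⁻ region z)
        -- The bound `n` on the size of the new region matters here: it makes the truncated
        -- subtraction strictly decreasing.
        (rec (ℕ.∸-monoʳ-< (ℕ.≤-reflexive (sym (weight-⊕ (λ _ → 1) region z∉region))) (∣∣≤n (region ⊕ z))))

  conn? : ∀ A → Dec (Conn A)
  conn? A with any? (_∈? A)
  ... | no  empty     = no (empty ∘ proj₁)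
  ... | yes (x , x∈A) = map′
    (λ A⊆region → conn-hub x∈A λ y y∈A → reach y (A⊆region y y∈A))
    (λ (_ , walk) y y∈A → walk-invariant (_∈ region) (λ z∈region (_ , v∈A , z∼v) → closed z∈region v∈A z∼v)
                            root (walk x y x∈A y∈A))
    (all? λ y → (y ∈? A) →-dec (y ∈? region))
    where open Component (component A x∈A)

  Dominated : VertexSet (Fin n) → Fin n → Set
  Dominated D x = x ∈ D ⊎ ∃ λ d → d ∈ D × x ∼ d

  dominated? : ∀ D → Decidable (Dominated D)
  dominated? D x = (x ∈? D) ⊎-dec any? λ d → (d ∈? D) ×-dec (x ∼? d)

  record CDS (S D : VertexSet (Fin n)) : Set where
    field
      D⊆S       : D ⊆ S
      conn      : Conn D
      dominates : ∀ x → x ∈ S → Dominated D x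

  record SplitOn (D : VertexSet (Fin n)) : Set where
    field
      K      : VertexSet (Fin n)
      clique : ∀ {x y} → x ∈ D → y ∈ D → x ∈ K → y ∈ K → x ≢ y → x ∼ y
      stable : ∀ {x y} → x ∈ D → y ∈ D → x ∉ K → y ∉ K → ¬ x ∼ y

  SplitDominated : VertexSet (Fin n) → Set
  SplitDominated S = ∃ λ D → CDS S D × SplitOn D

  undominated-or-all : ∀ D S → (∃ λ x → x ∈ S × ¬ Dominated D x) ⊎ (∀ x → x ∈ S → Dominated D x)
  undominated-or-all D S with any? (λ x → (x ∈? S) ×-dec ¬? (dominated? D x))
  ... | yes p = inj₁ p
  ... | no ¬p = inj₂ λ x x∈S → decidable-stable (dominated? D x) λ ¬dom → ¬p (x , x∈S , ¬dom)

  -- The tip is either a private neighbour of x or a vertex that x separates from f.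
  record Leaf (S A : VertexSet (Fin n)) (x f : Fin n) : Set where
    field
      tip   : Fin n
      tip∈S : tip ∈ S
      tip∼x : tip ∼ x
      comp  : Component (A ⊖ x) f
    open Component comp public
    field
      tip≁  : ∀ {c} → c ∈ region → ¬ tip ∼ c

    spread : ∀ {y z} → y ∈ region → z ∈ A → z ≢ x → y ∼ z → z ∈ region
    spread y∈region z∈A z≢x y∼z = closed y∈region (∈-⊖⁺ A x z∈A z≢x) y∼z

  -- The component of `f` misses some vertex of `A ⊖ x`. A walk in `A` from there to `f` can leave
  -- the missed part only through `x`, and the vertex just before `x` is the tip. That the tip is
  -- outside the region will keep tips of different leaves non-adjacent.
  cut-leaf : ∀ {f} → Conn A → x ∈ A → f ∈ A → f ≢ x → ¬ Conn (A ⊖ x) →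
             ∃ λ (ℓ : Leaf A A x f) → Leaf.tip ℓ ∉ Leaf.region ℓ
  cut-leaf {A} {x} {f} (_ , walk) x∈A f∈A f≢x ¬conn
    with any? (λ y → (y ∈? A ⊖ x) ×-dec ¬? (y ∈? region))
    where open Component (component (A ⊖ x) (∈-⊖⁺ A x f∈A f≢x))
  ... | no none = contradiction
    (conn-hub f∈A⊖x λ y y∈ → reach y (decidable-stable (y ∈? region) λ y∉region → none (y , y∈ , y∉region))) ¬conn
    where
    f∈A⊖x = ∈-⊖⁺ A x f∈A f≢x
    open Component (component (A ⊖ x) f∈A⊖x)
  ... | yes (y , y∈A⊖x , y∉region)
    with crossing (λ v → (v ∈? A ⊖ x) ×-dec ¬? (v ∈? region)) (walk y f y∈A f∈A) (y∈A⊖x , y∉region)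
           (λ (_ , f∉region) → f∉region root)
    where
    open Component (component (A ⊖ x) (∈-⊖⁺ A x f∈A f≢x))
    y∈A = proj₁ (∈-⊖⁻ A x y∈A⊖x)
  ... | t , q , (t∈A⊖x , t∉region) , ¬q , t∈A , q∈A , t∼q with q ≟ x
  ...   | yes refl = record
    { tip = t ; tip∈S = t∈A ; tip∼x = t∼q ; comp = comp
    ; tip≁ = λ c∈region t∼c → t∉region (closed c∈region t∈A⊖x (∼-sym t∼c)) } , t∉region
    where
    comp = component (A ⊖ x) (∈-⊖⁺ A x f∈A f≢x)
    open Component comp
  ...   | no q≢x = contradiction (q∈A⊖x , λ q∈region → t∉region (closed q∈region t∈A⊖x (∼-sym t∼q))) ¬q
    where
    q∈A⊖x = ∈-⊖⁺ A x q∈A q≢x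
    open Component (component (A ⊖ x) (∈-⊖⁺ A x f∈A f≢x))

  module _ {S D : VertexSet (Fin n)} {x f : Fin n}
           (cds : CDS S D) (x∈D : x ∈ D) (f∈D : f ∈ D) (f≢x : f ≢ x) where
    open CDS cds

    -- Only `x` can dominate `t`. Moreover `t` is not `x` itself: `D` is connected and contains `f`,
    -- so `x` has a neighbour in `D ⊖ x`.
    undominated⇒∼ : ∀ {t} → t ∈ S → ¬ Dominated (D ⊖ x) t → t ∼ x
    undominated⇒∼ {t} t∈S ¬dom with dominates t t∈S
    ... | inj₂ (d , d∈D , t∼d) with d ≟ x
    ...   | yes refl = t∼d
    ...   | no d≢x   = contradiction (inj₂ (d , ∈-⊖⁺ D x d∈D d≢x , t∼d)) ¬dom
    undominated⇒∼ {t} t∈S ¬dom | inj₁ t∈D with t ≟ x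
    ... | no t≢x   = contradiction (inj₁ (∈-⊖⁺ D x t∈D t≢x)) ¬dom
    ... | yes refl with neighbour conn x∈D f∈D f≢x
    ...   | z , z∈D , x∼z = contradiction (inj₂ (z , ∈-⊖⁺ D x z∈D (∼⇒≢ x∼z ∘ sym) , x∼z)) ¬dom

    private-leaf : ∀ {t} → t ∈ S → ¬ Dominated (D ⊖ x) t → Leaf S D x f
    private-leaf t∈S ¬dom = record
      { tip = _ ; tip∈S = t∈S ; tip∼x = undominated⇒∼ t∈S ¬dom
      ; comp = comp ; tip≁ = λ c∈region t∼c → ¬dom (inj₂ (_ , Component.region⊆A comp _ c∈region , t∼c)) }
      where comp = component (D ⊖ x) (∈-⊖⁺ D x f∈D f≢x)

    -- The dichotomy behind every deletion: if `D ⊖ x` fails, then either it is disconnected and the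
    -- tip lies in `D`, or it leaves a vertex undominated and the tip is a private neighbour of `x`.
    leaf : CDS S (D ⊖ x) ⊎ Leaf S D x f
    leaf with conn? (D ⊖ x)
    ... | no ¬conn = inj₂ record
      { Leaf (proj₁ ℓ) ; tip∈S = D⊆S _ (Leaf.tip∈S (proj₁ ℓ)) }
      where ℓ = cut-leaf conn x∈D f∈D f≢x ¬conn
    ... | yes connD⊖x with undominated-or-all (D ⊖ x) S
    ...   | inj₁ (t , t∈S , ¬dom) = inj₂ (private-leaf t∈S ¬dom)
    ...   | inj₂ dom = inj₁ record
      { D⊆S = λ v → D⊆S v ∘ proj₁ ∘ ∈-⊖⁻ D x ; conn = connD⊖x ; dominates = dom }

-- Graphs without 2K₂, C₄ and C₅ are split

module FoldesHammer {n : ℕ} (G : Graph (Fin n)) (X : VertexSet (Fin n)) where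
  open Graph G
  open Domination G

  module _
    (no-2K₂ : ∀ {x y a b} → x ∈ X → y ∈ X → a ∈ X → b ∈ X → x ∼ y → a ∼ b →
              ¬ x ∼ a → ¬ x ∼ b → ¬ y ∼ a → ¬ y ∼ b → ⊥)
    (no-C₄ : ∀ {a b c d} → a ∈ X → b ∈ X → c ∈ X → d ∈ X →
             a ∼ b → b ∼ c → c ∼ d → d ∼ a → a ≢ c → b ≢ d → ¬ a ∼ c → ¬ b ∼ d → ⊥)
    (no-C₅ : ∀ {a b c d e} → a ∈ X → b ∈ X → c ∈ X → d ∈ X → e ∈ X →
             a ∼ b → b ∼ c → c ∼ d → d ∼ e → e ∼ a →
             ¬ a ∼ c → ¬ b ∼ d → ¬ c ∼ e → ¬ d ∼ a → ¬ e ∼ b → ⊥)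
    where

    private
      nbrs? : ∀ a → Decidable λ v → v ∈ X × a ∼ v
      nbrs? a v = (v ∈? X) ×-dec (a ∼? v)

      degree : Fin n → ℕ
      degree a = ∣ ⟪ nbrs? a ⟫ ∣

      -- Any two vertices outweigh a single one, so a clique of maximal total value is
      -- one of maximal size and, among those, of maximal degree sum.
      value : Fin n → ℕ
      value a = n + suc (degree a)

      -- A degree is at most `n`, so one value is at most `n + suc n`, while two values already sum
      -- to at least `suc n + suc n`.
      value< : ∀ a x y → value a < value x + value y
      value< a x y = begin-strict
        n + suc (degree a)       ≤⟨ ℕ.+-monoʳ-≤ n (s≤s (∣∣≤n (⟪ nbrs? a ⟫))) ⟩
        n + suc n                ≤⟨ ℕ.m≤m+n (n + suc n) (degree y) ⟩
        n + suc n + degree y     <⟨ ℕ.+-mono-<-≤ (ℕ.+-monoʳ-< n (s≤s (ℕ.m<m+n n (s≤s z≤n)))) (ℕ.≤-refl {degree y}) ⟩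
        n + suc (n + suc (degree x)) + degree y ≡⟨ solve 3
          (λ n dx dy → n :+ (con 1 :+ (n :+ (con 1 :+ dx))) :+ dy := n :+ (con 1 :+ dx) :+ (n :+ (con 1 :+ dy)))
          refl n (degree x) (degree y) ⟩
        value x + value y        ∎
        where
        open ℕ.≤-Reasoning
        open +-*-Solver

      CliqueIn : VertexSet (Fin n) → Set
      CliqueIn K = K ⊆ X × (∀ {x y} → x ∈ K → y ∈ K → x ≢ y → x ∼ y)

      clique-⊕ : ∀ {K x} → CliqueIn K → x ∈ X → (∀ k → k ∈ K → x ∼ k) → CliqueIn (K ⊕ x)
      clique-⊕ {K} {x} (K⊆X , adj) x∈X x∼K =
        (λ v → [ K⊆X v , (λ { refl → x∈X }) ]′ ∘ ∈-⊕⁻ K x) ,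
        λ {u} {v} u∈ v∈ → pair (∈-⊕⁻ K x u∈) (∈-⊕⁻ K x v∈)
        where
        pair : ∀ {u v} → u ∈ K ⊎ u ≡ x → v ∈ K ⊎ v ≡ x → u ≢ v → u ∼ v
        pair (inj₁ u∈K)  (inj₁ v∈K)  u≢v = adj u∈K v∈K u≢v
        pair (inj₁ u∈K)  (inj₂ refl) u≢v = ∼-sym (x∼K _ u∈K)
        pair (inj₂ refl) (inj₁ v∈K)  u≢v = x∼K _ v∈K
        pair (inj₂ refl) (inj₂ refl) u≢v = contradiction refl u≢v

      clique-⊖ : ∀ {K} a → CliqueIn K → CliqueIn (K ⊖ a)
      clique-⊖ {K} a (K⊆X , adj) = (λ v → K⊆X v ∘ proj₁ ∘ ∈-⊖⁻ K a) ,
        λ x∈ y∈ → adj (proj₁ (∈-⊖⁻ K a x∈)) (proj₁ (∈-⊖⁻ K a y∈))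

      Better : VertexSet (Fin n) → Set
      Better K = ∃ λ K′ → CliqueIn K′ × weight value K < weight value K′

      extend : ∀ {K x} → CliqueIn K → x ∈ X → x ∉ K → (∀ k → k ∈ K → x ∼ k) → Better K
      extend {K} {x} cl x∈X x∉K x∼K = K ⊕ x , clique-⊕ cl x∈X x∼K ,
        subst (weight value K <_) (sym (weight-⊕ value K x∉K))
          (ℕ.m<n+m (weight value K) (ℕ.≤-trans (s≤s z≤n) (ℕ.m≤n+m _ n)))

      -- Trading a for x raises the degree sum, unless some z sees a but not x; then y can join as well.
      exchange : ∀ {K a x y} → CliqueIn K → a ∈ K → x ∈ X → y ∈ X → x ∉ K → y ∉ K → x ∼ y →
                 ¬ x ∼ a → ¬ y ∼ a → (∀ k → k ∈ K ⊖ a → x ∼ k) → Better K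
      exchange {K} {a} {x} {y} cl a∈K x∈X y∈X x∉K y∉K x∼y x≁a y≁a x∼K
        with any? (λ z → (z ∈? X) ×-dec (a ∼? z) ×-dec ¬? (x ∼? z))
      ... | no none = K ⊖ a ⊕ x , clique-⊕ (clique-⊖ a cl) x∈X x∼K ,
        subst₂ _<_ (sym (weight-⊖ value K a∈K)) (sym (weight-⊕ value (K ⊖ a) x∉K⊖a))
          (ℕ.+-monoˡ-< _ (ℕ.+-monoʳ-< n (s≤s
            -- The size of the clique is unchanged, and `y` is a neighbour of `x` but not of `a`, so
            -- the degree rises strictly.
            (∣∣-mono-< ⟪ nbrs? x ⟫ {x = y} N[a]⊆N[x] (y≁a ∘ ∼-sym ∘ proj₂ ∘ ⟪⟫⁻ (nbrs? a)) (⟪⟫⁺ (nbrs? x) (y∈X , x∼y))))))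
        where
        x∉K⊖a = x∉K ∘ proj₁ ∘ ∈-⊖⁻ K a
        N[a]⊆N[x] : ⟪ nbrs? a ⟫ ⊆ ⟪ nbrs? x ⟫
        N[a]⊆N[x] v v∈ = let v∈X , a∼v = ⟪⟫⁻ (nbrs? a) v∈ in
          ⟪⟫⁺ (nbrs? x) (v∈X , decidable-stable (x ∼? v) λ x≁v → none (v , v∈X , a∼v , x≁v))
      ... | yes (z , z∈X , a∼z , x≁z) with y ∼? z
      ...   | no y≁z = ⊥-elim (no-2K₂ x∈X y∈X a∈X z∈X x∼y a∼z x≁a x≁z y≁a y≁z)
        where a∈X = proj₁ cl a a∈K
      ...   | yes y∼z = K ⊖ a ⊕ x ⊕ y ,
        clique-⊕ (clique-⊕ (clique-⊖ a cl) x∈X x∼K) y∈X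
          (λ k → [ y∼K k , (λ { refl → ∼-sym x∼y }) ]′ ∘ ∈-⊕⁻ (K ⊖ a) x) ,
        (begin-strict
          weight value K                                  ≡⟨ weight-⊖ value K a∈K ⟩
          value a + weight value (K ⊖ a)                  <⟨ ℕ.+-monoˡ-< _ (value< a y x) ⟩
          value y + value x + weight value (K ⊖ a)        ≡⟨ ℕ.+-assoc (value y) (value x) _ ⟩
          value y + (value x + weight value (K ⊖ a))      ≡⟨ cong (value y +_) (weight-⊕ value (K ⊖ a) x∉K⊖a) ⟨
          value y + weight value (K ⊖ a ⊕ x)              ≡⟨ weight-⊕ value (K ⊖ a ⊕ x) y∉ ⟨
          weight value (K ⊖ a ⊕ x ⊕ y)                    ∎)
        where
        open ℕ.≤-Reasoning
        a∈X = proj₁ cl a a∈K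
        x∉K⊖a = x∉K ∘ proj₁ ∘ ∈-⊖⁻ K a
        y∉ = [ y∉K ∘ proj₁ ∘ ∈-⊖⁻ K a , ∼⇒≢ x∼y ∘ sym ]′ ∘ ∈-⊕⁻ (K ⊖ a) x
        -- A vertex `b` missed by `y` closes an induced cycle: `x y z b` if `z` sees `b`, and
        -- `x y z a b` otherwise.
        y∼K : ∀ b → b ∈ K ⊖ a → y ∼ b
        y∼K b b∈ with ∈-⊖⁻ K a b∈ | y ∼? b | z ∼? b
        ... | _           | yes y∼b | _       = y∼b
        ... | b∈K , b≢a | no y≁b  | yes z∼b = ⊥-elim
          (no-C₄ x∈X y∈X z∈X (proj₁ cl b b∈K) x∼y y∼z z∼b (∼-sym (x∼K b b∈))
            (λ { refl → x≁a (∼-sym a∼z) }) (λ { refl → y∉K b∈K }) x≁z y≁b)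
        ... | b∈K , b≢a | no y≁b  | no z≁b  = ⊥-elim
          (no-C₅ x∈X y∈X z∈X a∈X (proj₁ cl b b∈K) x∼y y∼z (∼-sym a∼z)
            (proj₂ cl a∈K b∈K (b≢a ∘ sym)) (∼-sym (x∼K b b∈))
            x≁z y≁a z≁b (≁-sym x≁a) (≁-sym y≁b))

      -- Two vertices of `K` missed by `x` are also missed by `y` and form 2K₂ with the edge `x y`.
      -- So `x` misses at most one vertex of `K`: it either joins `K` or is traded for that vertex.
      nested : ∀ {K x y} → CliqueIn K → x ∈ X → y ∈ X → x ∉ K → y ∉ K → x ∼ y →
               (∀ a → a ∈ K → ¬ x ∼ a → ¬ y ∼ a) → Better K
      nested {K} {x} cl x∈X y∈X x∉K y∉K x∼y x≁⇒y≁ with any? (λ a → (a ∈? K) ×-dec ¬? (x ∼? a))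
      ... | no none = extend cl x∈X x∉K λ k k∈K →
              decidable-stable (x ∼? k) λ x≁k → none (k , k∈K , x≁k)
      ... | yes (a , a∈K , x≁a) = exchange cl a∈K x∈X y∈X x∉K y∉K x∼y x≁a (x≁⇒y≁ a a∈K x≁a)
        λ b b∈ → decidable-stable (x ∼? b) λ x≁b → let b∈K , b≢a = ∈-⊖⁻ K a b∈ in
          no-2K₂ x∈X y∈X (proj₁ cl a a∈K) (proj₁ cl b b∈K) x∼y (proj₂ cl a∈K b∈K (b≢a ∘ sym))
            x≁a x≁b (x≁⇒y≁ a a∈K x≁a) (x≁⇒y≁ b b∈K x≁b)

      -- The neighbourhoods of `x` and `y` in `K` are nested, since otherwise `a` seen only by `y`
      -- and `b` seen only by `x` close the induced four-cycle `x y a b`.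
      improve : ∀ {K x y} → CliqueIn K → x ∈ X → y ∈ X → x ∉ K → y ∉ K → x ∼ y → Better K
      improve {K} {x} {y} cl x∈X y∈X x∉K y∉K x∼y
        with any? (λ a → (a ∈? K) ×-dec ¬? (x ∼? a) ×-dec (y ∼? a))
           | any? (λ b → (b ∈? K) ×-dec ¬? (y ∼? b) ×-dec (x ∼? b))
      ... | no none | _ = nested cl x∈X y∈X x∉K y∉K x∼y λ a a∈K x≁a y∼a → none (a , a∈K , x≁a , y∼a)
      ... | yes _ | no none = nested cl y∈X x∈X y∉K x∉K (∼-sym x∼y)
              λ b b∈K y≁b x∼b → none (b , b∈K , y≁b , x∼b)
      ... | yes (a , a∈K , x≁a , y∼a) | yes (b , b∈K , y≁b , x∼b) = ⊥-elim
        (no-C₄ x∈X y∈X (proj₁ cl a a∈K) (proj₁ cl b b∈K) x∼y y∼a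
          (proj₂ cl a∈K b∈K (λ { refl → x≁a x∼b })) (∼-sym x∼b)
          (λ { refl → x∉K a∈K }) (λ { refl → y∉K b∈K }) x≁a y≁b)

    -- Local search from the empty clique: an edge of `X` outside `K` yields a heavier clique, and
    -- `weight value X` bounds all of them.
    foldes-hammer : SplitOn X
    foldes-hammer = search (λ _ → false) ((λ _ ()) , λ ()) (<-wellFounded _)
      where
      search : ∀ K → CliqueIn K → Acc _<_ (weight value X ∸ weight value K) → SplitOn X
      search K cl (acc rec) with any? (λ x → any? λ y →
        (x ∈? X) ×-dec (y ∈? X) ×-dec ¬? (x ∈? K) ×-dec ¬? (y ∈? K) ×-dec (x ∼? y))
      ... | no none = record
        { K = K ; clique = λ _ _ → proj₂ cl
        ; stable = λ {x} {y} x∈X y∈X x∉K y∉K x∼y → none (x , y , x∈X , y∈X , x∉K , y∉K , x∼y) }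
      ... | yes (x , y , x∈X , y∈X , x∉K , y∉K , x∼y) with improve cl x∈X y∈X x∉K y∉K x∼y
      ...   | K′ , cl′ , K<K′ = search K′ cl′ (rec (ℕ.∸-monoʳ-< K<K′ (weight-mono value (proj₁ cl′))))

-- Induced copies of the forbidden graphs

-- Common interface to `Fin m` and `Fin m ⊎ Fin k`, the two kinds of vertex types in `𝓒`.
Searchable : Set → Set₁
Searchable W = {P : W → Set} → Decidable P → Dec (∃ P)

search-⊎ : ∀ {m k} → Searchable (Fin m ⊎ Fin k)
search-⊎ P? = map′ [ (λ (i , p) → inj₁ i , p) , (λ (j , p) → inj₂ j , p) ]′
  (λ { (inj₁ i , p) → inj₁ (i , p) ; (inj₂ j , p) → inj₂ (j , p) })
  (any? (P? ∘ inj₁) ⊎-dec any? (P? ∘ inj₂))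

module _ {W : Set} (H : Graph W) where
  private module H = Graph H

  -- A map that preserves and reflects adjacency identifies only vertices with the same neighbours,
  -- so on a twin-free graph it is automatically injective.
  TwinFree : Set
  TwinFree = ∀ x y → (∀ z → x H.∼ z → y H.∼ z) → (∀ z → y H.∼ z → x H.∼ z) → x ≡ y

  module _ (search : Searchable W) (_≟_ : DecidableEquality W) where

    Twins : Set
    Twins = ∃₂ λ x y → ¬ x ≡ y × ¬ ∃ λ z → (x H.∼ z × ¬ y H.∼ z) ⊎ (y H.∼ z × ¬ x H.∼ z)

    twins? : Dec Twins
    twins? = search λ x → search λ y → ¬? (x ≟ y) ×-dec ¬? (search λ z →
      ((x H.∼? z) ×-dec ¬? (y H.∼? z)) ⊎-dec ((y H.∼? z) ×-dec ¬? (x H.∼? z)))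

    ¬twins⇒twinFree : ¬ Twins → TwinFree
    ¬twins⇒twinFree ¬twins x y x⊆y y⊆x = decidable-stable (x ≟ y) λ x≢y →
      ¬twins (x , y , x≢y , λ { (z , inj₁ (x∼z , y≁z)) → y≁z (x⊆y z x∼z)
                              ; (z , inj₂ (y∼z , x≁z)) → x≁z (y⊆x z y∼z) })

Row : ∀ {m} → (Fin m → Set) → Set
Row {zero}  P = ⊤
Row {suc m} P = P zero × Row (P ∘ suc)

-- Lists the pairs `i < j` row by row as a nested tuple; the diagonal and the other half are
-- supplied by `triangle`.
Triangle : ∀ {m} → (Fin m → Fin m → Set) → Set
Triangle {zero}  R = ⊤
Triangle {suc m} R = Row (R zero ∘ suc) × Triangle λ i j → R (suc i) (suc j)

row : ∀ {m} {P : Fin m → Set} → Row P → ∀ i → P i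
row (p , ps) zero    = p
row (p , ps) (suc i) = row ps i

triangle : ∀ {m} {R : Fin m → Fin m → Set} → (∀ i → R i i) → (∀ {i j} → R i j → R j i) →
           Triangle R → ∀ i j → R i j
triangle rfl sm (r , rs) zero    zero    = rfl zero
triangle rfl sm (r , rs) zero    (suc j) = row r j
triangle rfl sm (r , rs) (suc i) zero    = sm (row r i)
triangle {R = R} rfl sm (r , rs) (suc i) (suc j) =
  triangle {R = λ i j → R (suc i) (suc j)} (rfl ∘ suc) sm rs i j

module Patterns {n : ℕ} (G : Graph (Fin n)) where
  open Graph G

  module _ {W : Set} (H : Graph W) (f : W → Fin n) where
    private module H = Graph H

    Induces : Set
    Induces = ∀ x y → x H.∼ y ⇔ f x ∼ f y

    -- For a concrete `H` this computes to a plain adjacency or non-adjacency in `G`, so a copy is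
    -- certified by a tuple of such facts.
    Agree : W → W → Set
    Agree x y = if does (x H.∼? y) then f x ∼ f y else ¬ f x ∼ f y

    agree-sym : ∀ {x y} → Agree x y → Agree y x
    agree-sym {x} {y} p with x H.∼? y | y H.∼? x
    ... | yes _   | yes _   = ∼-sym p
    ... | no _    | no _    = p ∘ ∼-sym
    ... | yes x∼y | no y≁x  = contradiction (H.∼-sym x∼y) y≁x
    ... | no x≁y  | yes y∼x = contradiction (H.∼-sym y∼x) x≁y

    agree-refl : ∀ x → Agree x x
    agree-refl x with x H.∼? x
    ... | yes x∼x = contradiction x∼x (H.∼-irrefl refl)
    ... | no _    = ∼-irrefl refl

    agree⇒induces : (∀ x y → Agree x y) → Induces
    agree⇒induces agree x y with x H.∼? y | agree x y
    ... | yes x∼y | p = mk⇔ (λ _ → p) (λ _ → x∼y)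
    ... | no x≁y  | p = mk⇔ (λ x∼y → contradiction x∼y x≁y) (λ q → contradiction q p)

    twinFree⇒injective : TwinFree H → Induces → ∀ {x y} → f x ≡ f y → x ≡ y
    twinFree⇒injective twinFree ind {x} {y} fx≡fy = twinFree x y
      (λ z x∼z → from y z (subst (_∼ f z) fx≡fy (to x z x∼z)))
      (λ z y∼z → from x z (subst (_∼ f z) (sym fx≡fy) (to y z y∼z)))
      where
      to = λ x y → Equivalence.to (ind x y)
      from = λ x y → Equivalence.from (ind x y)

    copy : Searchable W → (∀ {x y} → f x ≡ f y → x ≡ y) → Induces → ∃ λ S → (G [ S ]) ≅ H
    copy search inj ind = ⟪ image? ⟫ , record
      { vertices  = mk↔ₛ′ (λ (v , v∈) → proj₁ (⟪⟫⁻ image? v∈)) (λ x → f x , ⟪⟫⁺ image? (x , refl))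
          (λ x → inj (proj₂ (⟪⟫⁻ image? {f x} (⟪⟫⁺ image? (x , refl)))))
          (λ (v , v∈) → ≡-subtype (proj₂ (⟪⟫⁻ image? v∈)))
      ; adjacency = λ (u , u∈) (v , v∈) → mk⇔
          (λ u∼v → Equivalence.from (ind _ _)
            (subst₂ _∼_ (sym (proj₂ (⟪⟫⁻ image? u∈))) (sym (proj₂ (⟪⟫⁻ image? v∈))) u∼v))
          (λ x∼y → subst₂ _∼_ (proj₂ (⟪⟫⁻ image? u∈)) (proj₂ (⟪⟫⁻ image? v∈))
            (Equivalence.to (ind _ _) x∼y))
      }
      where
      image? : Decidable λ v → ∃ λ x → f x ≡ v
      image? v = search λ x → f x ≟ v

      ≡-subtype : ∀ {S : VertexSet (Fin n)} {u v} {u∈ : u ∈ S} {v∈ : v ∈ S} →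
                  u ≡ v → (u , u∈) ≡ (v , v∈)
      ≡-subtype refl = cong (_ ,_) (T-irrelevant _ _)

  induces : ∀ {m} (H : Graph (Fin m)) (f : Fin m → Fin n) → Triangle (Agree H f) → Induces H f
  induces H f t = agree⇒induces H f
    (triangle (agree-refl H f) (λ {x} {y} → agree-sym H f {x} {y}) t)

  module _ {m k} (H : Graph (Fin m)) (us : Vec (Fin m) k) (f : Fin m → Fin n) (g : Fin k → Fin n) where

    induces-leaves : Induces H f →
      (∀ i → f (lookup us i) ∼ g i) → (∀ x i → x ≢ lookup us i → ¬ f x ∼ g i) →
      (∀ i j → ¬ g i ∼ g j) → Induces (attachLeaves H us) [ f , g ]′
    induces-leaves ind at off stable (inj₁ x) (inj₁ y) = ind x y
    induces-leaves ind at off stable (inj₁ x) (inj₂ i) = mk⇔ (λ { refl → at i })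
      λ fx∼gi → decidable-stable (x ≟ lookup us i) λ x≢ → off x i x≢ fx∼gi
    induces-leaves ind at off stable (inj₂ i) (inj₁ x) = mk⇔ (λ { refl → ∼-sym (at i) })
      λ gi∼fx → decidable-stable (x ≟ lookup us i) λ x≢ → off x i x≢ (∼-sym gi∼fx)
    induces-leaves ind at off stable (inj₂ i) (inj₂ j) = mk⇔ ⊥-elim (stable i j)

P₇-twinFree : TwinFree (P 7)
P₇-twinFree = ¬twins⇒twinFree (P 7) any? _≟_ (from-no (twins? (P 7) any? _≟_))

C₇-twinFree : TwinFree (C 7)
C₇-twinFree = ¬twins⇒twinFree (C 7) any? _≟_ (from-no (twins? (C 7) any? _≟_))

C₅-twinFree : TwinFree (C 5)
C₅-twinFree = ¬twins⇒twinFree (C 5) any? _≟_ (from-no (twins? (C 5) any? _≟_))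

H₁-twinFree : TwinFree H₁
H₁-twinFree = ¬twins⇒twinFree H₁ any? _≟_ (from-no (twins? H₁ any? _≟_))

H₂-twinFree : TwinFree H₂
H₂-twinFree = ¬twins⇒twinFree H₂ any? _≟_ (from-no (twins? H₂ any? _≟_))

module _ {m k : ℕ} where
  _≟⊎_ : DecidableEquality (Fin m ⊎ Fin k)
  _≟⊎_ = Sum.≡-dec _≟_ _≟_

Q₁-twinFree : TwinFree Q₁
Q₁-twinFree = ¬twins⇒twinFree Q₁ search-⊎ _≟⊎_ (from-no (twins? Q₁ search-⊎ _≟⊎_))

Q₂-twinFree : TwinFree Q₂
Q₂-twinFree = ¬twins⇒twinFree Q₂ search-⊎ _≟⊎_ (from-no (twins? Q₂ search-⊎ _≟⊎_))

Q₃-twinFree : TwinFree Q₃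
Q₃-twinFree = ¬twins⇒twinFree Q₃ search-⊎ _≟⊎_ (from-no (twins? Q₃ search-⊎ _≟⊎_))

Q₄-twinFree : TwinFree Q₄
Q₄-twinFree = ¬twins⇒twinFree Q₄ search-⊎ _≟⊎_ (from-no (twins? Q₄ search-⊎ _≟⊎_))

module CFree {n : ℕ} (G : Graph (Fin n)) (free : 𝓒 -free G) where
  open Graph G
  open Patterns G

  private
    no-copy : ∀ {H} → H ∈ˡ 𝓒 → Searchable (proj₁ H) → TwinFree (proj₂ H) →
              ∀ f → ¬ Induces (proj₂ H) f
    no-copy {_ , H} H∈ search twinFree f ind =
      All.lookup free H∈ (copy H f search (twinFree⇒injective H f twinFree ind) ind)

  no-P₇ : ∀ f → ¬ Induces (P 7) f
  no-P₇ = no-copy (here refl) any? P₇-twinFree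

  no-C₇ : ∀ f → ¬ Induces (C 7) f
  no-C₇ = no-copy (there (here refl)) any? C₇-twinFree

  no-Q₁ : ∀ f → ¬ Induces Q₁ f
  no-Q₁ = no-copy (there (there (here refl))) search-⊎ Q₁-twinFree

  no-Q₂ : ∀ f → ¬ Induces Q₂ f
  no-Q₂ = no-copy (there (there (there (here refl)))) search-⊎ Q₂-twinFree

  no-Q₃ : ∀ f → ¬ Induces Q₃ f
  no-Q₃ = no-copy (there (there (there (there (here refl))))) search-⊎ Q₃-twinFree

  no-Q₄ : ∀ f → ¬ Induces Q₄ f
  no-Q₄ = no-copy (there (there (there (there (there (here refl)))))) search-⊎ Q₄-twinFree

  -- The ends a and g may be adjacent: then the seven vertices induce C₇ instead of P₇.
  no-chain : ∀ a b c d e f g →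
    a ∼ b → b ∼ c → c ∼ d → d ∼ e → e ∼ f → f ∼ g →
    ¬ a ∼ c → ¬ a ∼ d → ¬ a ∼ e → ¬ a ∼ f →
    ¬ b ∼ d → ¬ b ∼ e → ¬ b ∼ f → ¬ b ∼ g →
    ¬ c ∼ e → ¬ c ∼ f → ¬ c ∼ g →
    ¬ d ∼ f → ¬ d ∼ g →
    ¬ e ∼ g → ⊥
  no-chain a b c d e f g ab bc cd de ef fg ac ad ae af bd be bf bg ce cf cg df dg eg
    with a ∼? g
  ... | yes ag = no-C₇ (lookup vs) (induces (C 7) (lookup vs)
    ( (ab , ac , ad , ae , af , ag , tt) , (bc , bd , be , bf , bg , tt) , (cd , ce , cf , cg , tt)
    , (de , df , dg , tt) , (ef , eg , tt) , (fg , tt) , tt , tt))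
    where vs = a ∷ b ∷ c ∷ d ∷ e ∷ f ∷ g ∷ []
  ... | no ag = no-P₇ (lookup vs) (induces (P 7) (lookup vs)
    ( (ab , ac , ad , ae , af , ag , tt) , (bc , bd , be , bf , bg , tt) , (cd , ce , cf , cg , tt)
    , (de , df , dg , tt) , (ef , eg , tt) , (fg , tt) , tt , tt))
    where vs = a ∷ b ∷ c ∷ d ∷ e ∷ f ∷ g ∷ []

-- Connected dominating sets with a pendant path

module Tails {n : ℕ} (G : Graph (Fin n)) (free : 𝓒 -free G) where
  open Graph G
  open Domination G
  open Patterns G
  open CFree G free

  record LeafAt {m} (f : Fin m → Fin n) (z : Fin m) (t : Fin n) : Set where
    constructor leafAt
    field
      at  : f z ∼ t
      off : ∀ x → x ≢ z → ¬ f x ∼ t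

  open LeafAt

  -- Here k, x, y, u, v play the roles of a, b, c, d, e in H₁; if w ≁ s, then Q₃, P₇ or C₇ appears.
  no-H₁-leaves : ∀ k x y u v {w s t} → let f = lookup (k ∷ x ∷ y ∷ u ∷ v ∷ []) in
    Triangle (Agree H₁ f) → LeafAt f 4F w → LeafAt f 1F s → LeafAt f 2F t → w ∼ s
  no-H₁-leaves k x y u v {w} {s} {t}
    tri@((kx , ky , ku , kv , tt) , (xy , xu , xv , tt) , (yu , yv , tt) , (uv , tt) , tt , tt)
    lw ls lt = decidable-stable (w ∼? s) impossible
    where
    impossible : ¬ ¬ w ∼ s
    impossible w≁s with s ∼? t | w ∼? t
    ... | yes st | _ = no-chain w v u k x s t
      (∼-sym (at lw)) (∼-sym uv) (∼-sym ku) kx (at ls) st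
      (≁-sym (off lw 3F λ ())) (≁-sym (off lw 0F λ ())) (≁-sym (off lw 1F λ ())) w≁s
      (≁-sym kv) (≁-sym xv) (off ls 4F λ ()) (off lt 4F λ ())
      (≁-sym xu) (off ls 3F λ ()) (off lt 3F λ ())
      (off ls 0F λ ()) (off lt 0F λ ())
      (off lt 1F λ ())
    ... | no st | yes wt = no-chain u v w t y x s
      uv (at lw) wt (∼-sym (at lt)) (∼-sym xy) (at ls)
      (off lw 3F λ ()) (off lt 3F λ ()) (≁-sym yu) (≁-sym xu)
      (off lt 4F λ ()) (≁-sym yv) (≁-sym xv) (off ls 4F λ ())
      (≁-sym (off lw 2F λ ())) (≁-sym (off lw 1F λ ())) w≁s
      (≁-sym (off lt 1F λ ())) (≁-sym st)
      (off ls 2F λ ())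
    ... | no st | no wt = no-Q₃ _ (induces-leaves H₁ (1F ∷ 2F ∷ 4F ∷ []) f g
        (induces H₁ f tri) (at ∘ leaves) (λ x i → off (leaves i) x) stable)
      where
      f = lookup (k ∷ x ∷ y ∷ u ∷ v ∷ [])
      g = lookup (s ∷ t ∷ w ∷ [])

      leaves : ∀ i → LeafAt f (lookup (1F ∷ 2F ∷ 4F ∷ []) i) (g i)
      leaves 0F = ls
      leaves 1F = lt
      leaves 2F = lw

      stable : ∀ i j → ¬ g i ∼ g j
      stable 0F 0F = ∼-irrefl refl
      stable 0F 1F = st
      stable 0F 2F = ≁-sym w≁s
      stable 1F 0F = ≁-sym st
      stable 1F 1F = ∼-irrefl refl
      stable 1F 2F = ≁-sym wt
      stable 2F 0F = w≁s
      stable 2F 1F = wt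
      stable 2F 2F = ∼-irrefl refl

  module _ (S : VertexSet (Fin n)) where

    -- D ∪ w ends in the pendant path w v u, and u is simplicial in D ∖ v.
    record Tail (D : VertexSet (Fin n)) (w v u : Fin n) : Set where
      field
        cds    : CDS S D
        w∈S    : w ∈ S
        w∉D    : w ∉ D
        v∈D    : v ∈ D
        u∈D    : u ∈ D
        w∼v    : w ∼ v
        v∼u    : v ∼ u
        N[w]   : ∀ {d} → d ∈ D → w ∼ d → d ≡ v
        N[v]   : ∀ {d} → d ∈ D → v ∼ d → d ≡ u
        clique : ∀ {p q} → p ∈ D → q ∈ D → u ∼ p → u ∼ q → p ≢ v → q ≢ v → p ≢ q → p ∼ q

    tail-⊖ : ∀ {D w v u x} → Tail D w v u → x ≢ v → x ≢ u → CDS S (D ⊖ x) → Tail (D ⊖ x) w v u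
    tail-⊖ {D} {x = x} tail x≢v x≢u cds′ = record
      { cds = cds′ ; w∈S = w∈S ; w∉D = w∉D ∘ in-D
      ; v∈D = ∈-⊖⁺ D x v∈D (x≢v ∘ sym) ; u∈D = ∈-⊖⁺ D x u∈D (x≢u ∘ sym) ; w∼v = w∼v ; v∼u = v∼u
      ; N[w] = N[w] ∘ in-D ; N[v] = N[v] ∘ in-D ; clique = λ p∈ q∈ → clique (in-D p∈) (in-D q∈) }
      where
      open Tail tail
      in-D : ∀ {d} → d ∈ D ⊖ x → d ∈ D
      in-D = proj₁ ∘ ∈-⊖⁻ D x

    module TailStep {D w v u} (tail : Tail D w v u)
                (ih : ∀ {D′ w′ v′ u′} → Tail D′ w′ v′ u′ → ∣ D′ ∣ < ∣ D ∣ → SplitDominated S) where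
      open Tail tail
      open CDS cds

      shrink : ∀ {x} → x ∈ D → x ≢ v → x ≢ u → CDS S (D ⊖ x) → SplitDominated S
      shrink x∈D x≢v x≢u cds′ = ih (tail-⊖ tail x≢v x≢u cds′) (∣⊖∣< D x∈D)

      w≁ : ∀ {d} → d ∈ D → d ≢ v → ¬ w ∼ d
      w≁ d∈D d≢v = d≢v ∘ N[w] d∈D

      v≁ : ∀ {d} → d ∈ D → d ≢ u → ¬ v ∼ d
      v≁ d∈D d≢u = d≢u ∘ N[v] d∈D

      u≢v : u ≢ v
      u≢v = ∼⇒≢ v∼u ∘ sym

      -- A leaf at `c′` would prolong `w v u k c c′` to seven vertices, that is to P₇ or C₇. So `c′`
      -- can be deleted.
      far-path : ∀ {k c c′} → k ∈ D → c ∈ D → c′ ∈ D → u ∼ k → k ∼ c → c ∼ c′ →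
                 c ≢ u → ¬ u ∼ c → ¬ u ∼ c′ → ¬ k ∼ c′ → SplitDominated S
      far-path {k} {c} {c′} k∈D c∈D c′∈D u∼k k∼c c∼c′ c≢u u≁c u≁c′ k≁c′ = conclude (leaf cds c′∈D v∈D (c′≢v ∘ sym))
        where
        k≢u  = ∼⇒≢ u∼k ∘ sym
        c′≢u : c′ ≢ u
        c′≢u refl = u≁c (∼-sym c∼c′)
        k≢v : k ≢ v
        k≢v refl = c≢u (N[v] c∈D k∼c)
        c≢v : c ≢ v
        c≢v refl = k≢u (N[v] k∈D (∼-sym k∼c))
        c′≢v : c′ ≢ v
        c′≢v refl = c≢u (N[v] c∈D (∼-sym c∼c′))
        c′≢k : c′ ≢ k
        c′≢k refl = u≁c′ u∼k

        conclude : CDS S (D ⊖ c′) ⊎ Leaf S D c′ v → SplitDominated S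
        conclude (inj₁ cds′) = shrink c′∈D c′≢v c′≢u cds′
        conclude (inj₂ ℓ) = ⊥-elim (no-chain w v u k c c′ tip
          w∼v v∼u u∼k k∼c c∼c′ (∼-sym tip∼x)
          (w≁ u∈D u≢v) (w≁ k∈D k≢v) (w≁ c∈D c≢v) (w≁ c′∈D c′≢v)
          (v≁ k∈D k≢u) (v≁ c∈D c≢u) (v≁ c′∈D c′≢u) (≁-sym (tip≁ root))
          u≁c u≁c′ (≁-sym (tip≁ u∈))
          k≁c′ (≁-sym (tip≁ k∈))
          (≁-sym (tip≁ (spread k∈ c∈D (∼⇒≢ c∼c′) k∼c))))
          where
          open Leaf ℓ
          u∈ = spread root u∈D (c′≢u ∘ sym) v∼u
          k∈ = spread u∈ k∈D (c′≢k ∘ sym) u∼k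

      module Kite {k x y} (k∈D : k ∈ D) (x∈D : x ∈ D) (y∈D : y ∈ D) (u∼k : u ∼ k) (k∼x : k ∼ x)
                  (k∼y : k ∼ y) (x∼y : x ∼ y) (x≢u : x ≢ u) (y≢u : y ≢ u)
                  (u≁x : ¬ u ∼ x) (u≁y : ¬ u ∼ y) where

        k≢u  = ∼⇒≢ u∼k ∘ sym
        k≢v : k ≢ v
        k≢v refl = x≢u (N[v] x∈D k∼x)
        x≢v : x ≢ v
        x≢v refl = k≢u (N[v] k∈D (∼-sym k∼x))
        y≢v : y ≢ v
        y≢v refl = k≢u (N[v] k∈D (∼-sym k∼y))

        f = lookup (k ∷ x ∷ y ∷ u ∷ v ∷ [])

        triangle-H₁ : Triangle (Agree H₁ f)
        triangle-H₁ = (k∼x , k∼y , ∼-sym u∼k , ≁-sym (v≁ k∈D k≢u) , tt)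
          , (x∼y , ≁-sym u≁x , ≁-sym (v≁ x∈D x≢u) , tt) , (≁-sym u≁y , ≁-sym (v≁ y∈D y≢u) , tt)
          , (∼-sym v∼u , tt) , tt , tt

        leaf-w : LeafAt f 4F w
        leaf-w = leafAt (∼-sym w∼v) λ
          { 0F _ → ≁-sym (w≁ k∈D k≢v) ; 1F _ → ≁-sym (w≁ x∈D x≢v) ; 2F _ → ≁-sym (w≁ y∈D y≢v)
          ; 3F _ → ≁-sym (w≁ u∈D u≢v) ; 4F 4≢4 → contradiction refl 4≢4 }

        leaf-x : ∀ {A} (ℓ : Leaf A D x v) → LeafAt f 1F (Leaf.tip ℓ)
        leaf-x ℓ = leafAt (∼-sym tip∼x) λ
          { 0F _ → ≁-sym (tip≁ k∈) ; 1F 1≢1 → contradiction refl 1≢1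
          ; 2F _ → ≁-sym (tip≁ (spread k∈ y∈D (∼⇒≢ x∼y ∘ sym) k∼y))
          ; 3F _ → ≁-sym (tip≁ u∈) ; 4F _ → ≁-sym (tip≁ root) }
          where
          open Leaf ℓ
          u∈ = spread root u∈D (x≢u ∘ sym) v∼u
          k∈ = spread u∈ k∈D (∼⇒≢ k∼x) u∼k

        leaf-y : ∀ {A} (ℓ : Leaf A D y v) → LeafAt f 2F (Leaf.tip ℓ)
        leaf-y ℓ = leafAt (∼-sym tip∼x) λ
          { 0F _ → ≁-sym (tip≁ k∈) ; 2F 2≢2 → contradiction refl 2≢2
          ; 1F _ → ≁-sym (tip≁ (spread k∈ x∈D (∼⇒≢ x∼y) k∼x))
          ; 3F _ → ≁-sym (tip≁ u∈) ; 4F _ → ≁-sym (tip≁ root) }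
          where
          open Leaf ℓ
          u∈ = spread root u∈D (y≢u ∘ sym) v∼u
          k∈ = spread u∈ k∈D (∼⇒≢ k∼y) u∼k

        -- w can replace x, and after that y is superfluous.
        module Exchange (connD⊖x : Conn (D ⊖ x)) {z} (z∈S : z ∈ S) (z≁D⊖x : ¬ Dominated (D ⊖ x) z)
                        (w∼private : ∀ t → t ∈ S → ¬ Dominated (D ⊖ x) t → w ∼ t) where

          E : VertexSet (Fin n)
          E = D ⊖ x ⊕ w

          w∉D⊖x : w ∉ D ⊖ x
          w∉D⊖x = w∉D ∘ proj₁ ∘ ∈-⊖⁻ D x

          keep : ∀ {d} → d ∈ D → d ≢ x → d ∈ E
          keep d∈D d≢x = ∈-⊕⁺ (D ⊖ x) w (∈-⊖⁺ D x d∈D d≢x)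

          cds-E : CDS S E
          cds-E = record
            { D⊆S = λ d → [ D⊆S d ∘ proj₁ ∘ ∈-⊖⁻ D x , (λ { refl → w∈S }) ]′ ∘ ∈-⊕⁻ (D ⊖ x) w
            ; conn = conn-hub v∈E λ d → [ walk d , (λ { refl → (v∈E , x∈S⊕x (D ⊖ x) w , ∼-sym w∼v) ◅ ε }) ]′
                                        ∘ ∈-⊕⁻ (D ⊖ x) w
            ; dominates = dom }
            where
            v∈E = keep v∈D (x≢v ∘ sym)
            walk : ∀ d → d ∈ D ⊖ x → Walk E v d
            walk d d∈ = walk-mono (λ _ → ∈-⊕⁺ (D ⊖ x) w) (proj₂ connD⊖x v d (∈-⊖⁺ D x v∈D (x≢v ∘ sym)) d∈)
            dom : ∀ t → t ∈ S → Dominated E t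
            dom t t∈S with dominated? (D ⊖ x) t
            ... | yes (inj₁ t∈)             = inj₁ (∈-⊕⁺ (D ⊖ x) w t∈)
            ... | yes (inj₂ (d , d∈ , t∼d)) = inj₂ (d , ∈-⊕⁺ (D ⊖ x) w d∈ , t∼d)
            ... | no ¬dom = inj₂ (w , x∈S⊕x (D ⊖ x) w , ∼-sym (w∼private t t∈S ¬dom))

          -- Swapping `x` for `w` alone makes no progress; the strict decrease comes from deleting
          -- `y` afterwards.
          ∣E∣≡∣D∣ : ∣ E ∣ ≡ ∣ D ∣
          ∣E∣≡∣D∣ = trans (weight-⊕ (λ _ → 1) (D ⊖ x) w∉D⊖x) (sym (weight-⊖ (λ _ → 1) D x∈D))

          w∼z : w ∼ z
          w∼z = w∼private z z∈S z≁D⊖x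

          z≁′ : ∀ {d} → d ∈ D ⊖ x → ¬ z ∼ d
          z≁′ d∈ z∼d = z≁D⊖x (inj₂ (_ , d∈ , z∼d))

          z≁ : ∀ {d} → d ∈ D → d ≢ x → ¬ z ∼ d
          z≁ d∈D d≢x = z≁′ (∈-⊖⁺ D x d∈D d≢x)

          y≢x : y ≢ x
          y≢x = ∼⇒≢ x∼y ∘ sym

          w≢y : w ≢ y
          w≢y refl = w∉D y∈D

          v≢y : v ≢ y
          v≢y = y≢v ∘ sym

          -- The pendant path moves on to `z w v`. Apart from `w`, the only neighbour of `v` is `u`,
          -- so the clique condition at `v` is vacuous.
          tail-E⊖y : CDS S (E ⊖ y) → Tail (E ⊖ y) z w v
          tail-E⊖y cds′ = record
            { cds = cds′ ; w∈S = z∈S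
            ; w∉D = [ z≁D⊖x ∘ inj₁ , ∼⇒≢ w∼z ∘ sym ]′ ∘ in-E
            ; v∈D = ∈-⊖⁺ E y (x∈S⊕x (D ⊖ x) w) w≢y
            ; u∈D = ∈-⊖⁺ E y (keep v∈D (x≢v ∘ sym)) v≢y
            ; w∼v = ∼-sym w∼z ; v∼u = w∼v
            ; N[w] = λ d∈ z∼d → [ (λ d∈D⊖x → contradiction z∼d (z≁′ d∈D⊖x)) , id ]′ (in-E d∈)
            ; N[v] = λ d∈ w∼d → [ (λ d∈D⊖x → N[w] (proj₁ (∈-⊖⁻ D x d∈D⊖x)) w∼d)
                                , (λ { refl → contradiction w∼d (∼-irrefl refl) }) ]′ (in-E d∈)
            ; clique = λ p∈ q∈ v∼p v∼q p≢w q≢w p≢q → contradiction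
                (trans (only-u p∈ v∼p p≢w) (sym (only-u q∈ v∼q q≢w))) p≢q }
            where
            in-E : ∀ {d} → d ∈ E ⊖ y → d ∈ D ⊖ x ⊎ d ≡ w
            in-E = ∈-⊕⁻ (D ⊖ x) w ∘ proj₁ ∘ ∈-⊖⁻ E y
            only-u : ∀ {p} → p ∈ E ⊖ y → v ∼ p → p ≢ w → p ≡ u
            only-u p∈ v∼p p≢w = [ (λ p∈D⊖x → N[v] (proj₁ (∈-⊖⁻ D x p∈D⊖x)) v∼p)
                                , (λ p≡w → contradiction p≡w p≢w) ]′ (in-E p∈)

          -- A leaf at `y` would prolong `z w v u k y` to P₇ or C₇.
          result : SplitDominated S
          result with leaf cds-E (keep y∈D y≢x) (x∈S⊕x (D ⊖ x) w) w≢y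
          ... | inj₁ cds′ = ih (tail-E⊖y cds′)
                              (subst (∣ E ⊖ y ∣ <_) ∣E∣≡∣D∣ (∣⊖∣< E (keep y∈D y≢x)))
          ... | inj₂ ℓ = ⊥-elim (no-chain z w v u k y tip
            (∼-sym w∼z) w∼v v∼u u∼k k∼y (∼-sym tip∼x)
            (z≁ v∈D v≢x) (z≁ u∈D u≢x) (z≁ k∈D k≢x) (z≁ y∈D y≢x)
            (w≁ u∈D u≢v) (w≁ k∈D k≢v) (w≁ y∈D y≢v) (≁-sym (tip≁ root))
            (v≁ k∈D k≢u) (v≁ y∈D y≢u) (≁-sym (tip≁ v∈))
            u≁y (≁-sym (tip≁ u∈))
            (≁-sym (tip≁ (spread u∈ (keep k∈D k≢x) (∼⇒≢ k∼y) u∼k))))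
            where
            open Leaf ℓ
            v≢x = x≢v ∘ sym
            u≢x = x≢u ∘ sym
            k≢x = ∼⇒≢ k∼x
            v∈ = spread root (keep v∈D v≢x) v≢y w∼v
            u∈ = spread v∈ (keep u∈D u≢x) (y≢u ∘ sym) v∼u

        -- Suppose that neither `x` nor `y` can be deleted. By `no-H₁-leaves` every tip at `x` is
        -- then adjacent to `w`. A tip inside `D` would have to be `v`, which does not see `x`.
        -- Hence `D ⊖ x` is connected, and the vertices it leaves undominated are all adjacent to
        -- `w`.
        result : SplitDominated S
        result with leaf cds y∈D v∈D (y≢v ∘ sym)
        ... | inj₁ cds′ = shrink y∈D y≢v y≢u cds′
        ... | inj₂ ℓy with conn? (D ⊖ x)
        ...   | no ¬conn = contradiction (N[v] x∈D (subst (_∼ x) tip≡v tip∼x)) x≢u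
          where
          ℓx = proj₁ (cut-leaf conn x∈D v∈D (x≢v ∘ sym) ¬conn)
          open Leaf ℓx
          tip≡v = N[w] tip∈S (no-H₁-leaves k x y u v triangle-H₁ leaf-w (leaf-x ℓx) (leaf-y ℓy))
        ...   | yes connD⊖x with undominated-or-all (D ⊖ x) S
        ...     | inj₂ dom = shrink x∈D x≢v x≢u record
          { D⊆S = λ d → D⊆S d ∘ proj₁ ∘ ∈-⊖⁻ D x ; conn = connD⊖x ; dominates = dom }
        ...     | inj₁ (z , z∈S , ¬dom) = Exchange.result connD⊖x z∈S ¬dom λ t t∈S ¬dom →
          no-H₁-leaves k x y u v triangle-H₁ leaf-w
            (leaf-x (private-leaf cds x∈D v∈D (x≢v ∘ sym) t∈S ¬dom)) (leaf-y ℓy)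

      Near : Fin n → Set
      Near z = z ≡ u ⊎ u ∼ z ⊎ ∃ λ k → k ∈ D × u ∼ k × k ∼ z

      near? : Decidable Near
      near? z = (z ≟ u) ⊎-dec (u ∼? z) ⊎-dec any? λ k → (k ∈? D) ×-dec (u ∼? k) ×-dec (k ∼? z)

      -- A vertex of `D` at distance three from `u` yields `far-path`. An edge of `D` outside the
      -- closed neighbourhood of `u` yields `Kite` or `far-path`. With neither present, `D` is split
      -- already.
      result : SplitDominated S
      result with any? (λ z → (z ∈? D) ×-dec ¬? (near? z))
      ... | yes (z , z∈D , ¬near) with crossing near? (proj₂ conn u z u∈D z∈D) (inj₁ refl) ¬near
      ...   | p , q , inj₁ refl , ¬near-q , _ , _ , p∼q = contradiction (inj₂ (inj₁ p∼q)) ¬near-q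
      ...   | p , q , inj₂ (inj₁ u∼p) , ¬near-q , p∈D , _ , p∼q =
              contradiction (inj₂ (inj₂ (p , p∈D , u∼p , p∼q))) ¬near-q
      ...   | p , q , inj₂ (inj₂ (k , k∈D , u∼k , k∼p)) , ¬near-q , p∈D , q∈D , p∼q =
              far-path k∈D p∈D q∈D u∼k k∼p p∼q
                (λ { refl → ¬near-q (inj₂ (inj₁ p∼q)) })
                (λ u∼p → ¬near-q (inj₂ (inj₂ (p , p∈D , u∼p , p∼q))))
                (¬near-q ∘ inj₂ ∘ inj₁) (λ k∼q → ¬near-q (inj₂ (inj₂ (k , k∈D , u∼k , k∼q))))
      result | no allNear with any? (λ x → any? λ y → (x ∈? D) ×-dec (y ∈? D) ×-dec (x ∼? y) ×-dec
                 ¬? (x ≟ u) ×-dec ¬? (y ≟ u) ×-dec ¬? (u ∼? x) ×-dec ¬? (u ∼? y))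
      ... | yes (x , y , x∈D , y∈D , x∼y , x≢u , y≢u , u≁x , u≁y)
        with decidable-stable (near? x) (λ ¬near → allNear (x , x∈D , ¬near))
      ...   | inj₁ x≡u = contradiction x≡u x≢u
      ...   | inj₂ (inj₁ u∼x) = contradiction u∼x u≁x
      ...   | inj₂ (inj₂ (k , k∈D , u∼k , k∼x)) with k ∼? y
      ...     | yes k∼y = Kite.result k∈D x∈D y∈D u∼k k∼x k∼y x∼y x≢u y≢u u≁x u≁y
      ...     | no k≁y  = far-path k∈D x∈D y∈D u∼k k∼x x∼y x≢u u≁x u≁y k≁y
      result | no allNear | no none = D , cds , record
        { K = ⟪ K? ⟫
        ; clique = λ p∈D q∈D p∈K q∈K → cl p∈D q∈D (⟪⟫⁻ K? p∈K) (⟪⟫⁻ K? q∈K)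
        ; stable = λ p∈D q∈D p∉K q∉K p∼q → none
            (_ , _ , p∈D , q∈D , p∼q , ≢u p∉K , ≢u q∉K
            , u≁ p∈D q∈D p∉K q∉K p∼q , u≁ q∈D p∈D q∉K p∉K (∼-sym p∼q)) }
        where
        -- The clique part is the closed neighbourhood of `u` without `v`. As `v` is pendant at `u`,
        -- it belongs to the stable part.
        K? : Decidable λ z → z ≡ u ⊎ (u ∼ z × z ≢ v)
        K? z = (z ≟ u) ⊎-dec ((u ∼? z) ×-dec ¬? (z ≟ v))
        cl : ∀ {p q} → p ∈ D → q ∈ D → p ≡ u ⊎ (u ∼ p × p ≢ v) → q ≡ u ⊎ (u ∼ q × q ≢ v) →
             p ≢ q → p ∼ q
        cl _ _ (inj₁ refl) (inj₁ refl) p≢q = contradiction refl p≢q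
        cl _ _ (inj₁ refl) (inj₂ (u∼q , _)) _ = u∼q
        cl _ _ (inj₂ (u∼p , _)) (inj₁ refl) _ = ∼-sym u∼p
        cl p∈D q∈D (inj₂ (u∼p , p≢v)) (inj₂ (u∼q , q≢v)) p≢q = clique p∈D q∈D u∼p u∼q p≢v q≢v p≢q
        ≢u : ∀ {p} → p ∉ ⟪ K? ⟫ → p ≢ u
        ≢u p∉K p≡u = p∉K (⟪⟫⁺ K? (inj₁ p≡u))
        u≁ : ∀ {p q} → p ∈ D → q ∈ D → p ∉ ⟪ K? ⟫ → q ∉ ⟪ K? ⟫ → p ∼ q → ¬ u ∼ p
        u≁ {p} p∈D q∈D p∉K q∉K p∼q u∼p with p ≟ v
        ... | yes refl = ≢u q∉K (N[v] q∈D p∼q)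
        ... | no p≢v   = p∉K (⟪⟫⁺ K? (inj₂ (u∼p , p≢v)))

    tail⇒splitDominated : ∀ {D w v u} → Tail D w v u → SplitDominated S
    tail⇒splitDominated tail = go tail (<-wellFounded _)
      where
      go : ∀ {D w v u} → Tail D w v u → Acc _<_ ∣ D ∣ → SplitDominated S
      go tail (acc rec) = TailStep.result tail λ tail′ <D → go tail′ (rec <D)

-- Sets of cut vertices

-- A walk through all vertices of H except x, so x is not a cut vertex.
Route : ∀ {m} → Graph (Fin m) → Fin m → Fin m × List (Fin m) → Set
Route H x (j , js) = Linked (Graph._∼_ H) (j ∷ js) × All (_≢ x) (j ∷ js) × (∀ y → y ≢ x → y ∈ˡ j ∷ js)

route? : ∀ {m} (H : Graph (Fin m)) x r → Dec (Route H x r)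
route? H x (j , js) = linked? (Graph._∼?_ H) (j ∷ js) ×-dec All.all? (λ y → ¬? (y ≟ x)) (j ∷ js)
  ×-dec all? λ y → ¬? (y ≟ x) →-dec (y ∈ˡ? j ∷ js)
  where open DecMembership _≟_ using () renaming (_∈?_ to _∈ˡ?_)

record NonCut {m k} (H : Graph (Fin m)) (us : Vec (Fin m) k) : Set where
  constructor nonCut
  field
    routes   : Vec (Fin m × List (Fin m)) k
    valid    : ∀ i → Route H (lookup us i) (lookup routes i)
    distinct : ∀ i j → i ≢ j → lookup us i ≢ lookup us j

valid? : ∀ {m k} (H : Graph (Fin m)) (us : Vec (Fin m) k) routes →
         Dec (∀ i → Route H (lookup us i) (lookup routes i))
valid? H us routes = all? λ i → route? H (lookup us i) (lookup routes i)

distinct? : ∀ {m k} (us : Vec (Fin m) k) → Dec (∀ i j → i ≢ j → lookup us i ≢ lookup us j)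
distinct? us = all? λ i → all? λ j → ¬? (i ≟ j) →-dec ¬? (lookup us i ≟ lookup us j)

nonCut-C₅ : NonCut (C 5) (allFin 5)
nonCut-C₅ = nonCut routes (from-yes (valid? (C 5) (allFin 5) routes)) (from-yes (distinct? (allFin 5)))
  where
  routes = (1F , 2F ∷ 3F ∷ 4F ∷ []) ∷ (2F , 3F ∷ 4F ∷ 0F ∷ []) ∷ (3F , 4F ∷ 0F ∷ 1F ∷ [])
         ∷ (4F , 0F ∷ 1F ∷ 2F ∷ []) ∷ (0F , 1F ∷ 2F ∷ 3F ∷ []) ∷ []

nonCut-C₄ : NonCut (C 4) (allFin 4)
nonCut-C₄ = nonCut routes (from-yes (valid? (C 4) (allFin 4) routes)) (from-yes (distinct? (allFin 4)))
  where
  routes = (1F , 2F ∷ 3F ∷ []) ∷ (2F , 3F ∷ 0F ∷ []) ∷ (3F , 0F ∷ 1F ∷ [])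
         ∷ (0F , 1F ∷ 2F ∷ []) ∷ []

nonCut-H₁ : NonCut H₁ (1F ∷ 2F ∷ 4F ∷ [])
nonCut-H₁ = nonCut routes (from-yes (valid? H₁ (1F ∷ 2F ∷ 4F ∷ []) routes)) (from-yes (distinct? (1F ∷ 2F ∷ 4F ∷ [])))
  where
  routes = (2F , 0F ∷ 3F ∷ 4F ∷ []) ∷ (1F , 0F ∷ 3F ∷ 4F ∷ []) ∷ (1F , 2F ∷ 0F ∷ 3F ∷ []) ∷ []

nonCut-H₂ : NonCut H₂ (1F ∷ 2F ∷ 3F ∷ 4F ∷ [])
nonCut-H₂ = nonCut routes (from-yes (valid? H₂ (1F ∷ 2F ∷ 3F ∷ 4F ∷ []) routes)) (from-yes (distinct? (1F ∷ 2F ∷ 3F ∷ 4F ∷ [])))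
  where
  routes = (2F , 0F ∷ 3F ∷ 4F ∷ []) ∷ (1F , 0F ∷ 3F ∷ 4F ∷ [])
         ∷ (4F , 0F ∷ 1F ∷ 2F ∷ []) ∷ (3F , 0F ∷ 1F ∷ 2F ∷ []) ∷ []

module CutCore {n : ℕ} (G : Graph (Fin n)) (free : 𝓒 -free G) where
  open Graph G
  open Domination G
  open Patterns G
  open CFree G free

  module _ {S X : VertexSet (Fin n)} (connS : Conn S) (X⊆S : X ⊆ S) (connX : Conn X)
           (cut : ∀ x → x ∈ X → ¬ Conn (S ⊖ x)) where

    private
      leafOf : ∀ {x f} → x ∈ X → f ∈ X → f ≢ x → ∃ λ (ℓ : Leaf S S x f) → Leaf.tip ℓ ∉ Leaf.region ℓ
      leafOf x∈X f∈X f≢x = cut-leaf connS (X⊆S _ x∈X) (X⊆S _ f∈X) f≢x (cut _ x∈X)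

      module _ {m k} {H : Graph (Fin m)} {us : Vec (Fin m) k} (nc : NonCut H us)
               (f : Fin m → Fin n) (f-inj : ∀ {i j} → f i ≡ f j → i ≡ j) (f∈X : ∀ i → f i ∈ X)
               (ind : Induces H f) where
        private module H = Graph H
        open NonCut nc

        ℓ : ∀ i → ∃ λ (ℓ : Leaf S S (f (lookup us i)) (f (proj₁ (lookup routes i)))) →
                       Leaf.tip ℓ ∉ Leaf.region ℓ
        ℓ i = let _ , avoids , _ = valid i in leafOf (f∈X _) (f∈X _) (All.head avoids ∘ f-inj)

        -- The base of the leaf is not a cut vertex of `H`, so the rest of the copy stays in one
        -- component once that base is removed from `S`: the route carries membership along from its
        -- first vertex, the root.
        covers : ∀ i x → x ≢ lookup us i → f x ∈ Leaf.region (proj₁ (ℓ i))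
        covers i x x≢u = let linked , avoids , all = valid i in
          All.lookup (along linked avoids (Leaf.root (proj₁ (ℓ i)))) (all x x≢u)
          where
          along : ∀ {j js} → Linked H._∼_ (j ∷ js) → All (_≢ lookup us i) (j ∷ js) →
                  f j ∈ Leaf.region (proj₁ (ℓ i)) → All (λ y → f y ∈ Leaf.region (proj₁ (ℓ i))) (j ∷ js)
          along [-]        _               j∈ = j∈ ∷ []
          along (j∼k ∷ ks) (_ ∷ k≢u ∷ ≢us) j∈ = j∈ ∷ along ks (k≢u ∷ ≢us)
            (Leaf.spread (proj₁ (ℓ i)) j∈ (X⊆S _ (f∈X _)) (k≢u ∘ f-inj) (Equivalence.to (ind _ _) j∼k))

        leaves-attached : ∃ λ h → Induces (attachLeaves H us) h
        leaves-attached = _ , induces-leaves H us f (λ i → Leaf.tip (proj₁ (ℓ i))) ind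
          (λ i → ∼-sym (Leaf.tip∼x (proj₁ (ℓ i))))
          (λ x i x≢u → ≁-sym (Leaf.tip≁ (proj₁ (ℓ i)) (covers i x x≢u)))
          stable
          where
          -- A tip adjacent to the tip at u would lie on the far side of u together with its own base.
          stable : ∀ i j → ¬ Leaf.tip (proj₁ (ℓ i)) ∼ Leaf.tip (proj₁ (ℓ j))
          stable i j with i ≟ j
          ... | yes refl = ∼-irrefl refl
          ... | no i≢j   = Leaf.tip≁ (proj₁ (ℓ i)) (Leaf.spread (proj₁ (ℓ i))
            (covers i (lookup us j) (distinct i j i≢j ∘ sym)) (Leaf.tip∈S (proj₁ (ℓ j)))
            (λ tip≡ → proj₂ (ℓ j) (subst (_∈ Leaf.region (proj₁ (ℓ j))) (sym tip≡)
              (covers j (lookup us i) (distinct i j i≢j))))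
            (∼-sym (Leaf.tip∼x (proj₁ (ℓ j)))))

      -- Leaves at the two ends prolong the path to seven vertices.
      no-P₅ : ∀ {a b c d e} → a ∈ X → b ∈ X → c ∈ X → d ∈ X → e ∈ X →
              a ∼ b → b ∼ c → c ∼ d → d ∼ e →
              ¬ a ∼ c → ¬ a ∼ d → ¬ a ∼ e → ¬ b ∼ d → ¬ b ∼ e → ¬ c ∼ e → ⊥
      no-P₅ {a} {b} {c} {d} {e} a∈ b∈ c∈ d∈ e∈ ab bc cd de ac ad ae bd be ce =
        no-chain A.tip a b c d e E.tip
          A.tip∼x ab bc cd de (∼-sym E.tip∼x)
          (A.tip≁ A.root) (A.tip≁ Ac) (A.tip≁ Ad) (A.tip≁ Ae)
          ac ad ae (≁-sym (E.tip≁ Ea)) bd be (≁-sym (E.tip≁ Eb)) ce (≁-sym (E.tip≁ Ec))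
          (≁-sym (E.tip≁ E.root))
        where
        module A = Leaf (proj₁ (leafOf a∈ b∈ (∼⇒≢ ab ∘ sym)))
        module E = Leaf (proj₁ (leafOf e∈ d∈ (∼⇒≢ de)))
        Ac = A.spread A.root (X⊆S _ c∈) (λ { refl → ad cd }) bc
        Ad = A.spread Ac (X⊆S _ d∈) (λ { refl → ae de }) cd
        Ae = A.spread Ad (X⊆S _ e∈) (λ { refl → ad (∼-sym de) }) de
        Ec = E.spread E.root (X⊆S _ c∈) (λ { refl → be bc }) (∼-sym cd)
        Eb = E.spread Ec (X⊆S _ b∈) (λ { refl → ae ab }) (∼-sym bc)
        Ea = E.spread Eb (X⊆S _ a∈) (λ { refl → be (∼-sym ab) }) (∼-sym ab)

      module _ {a b c d e} (a∈ : a ∈ X) (b∈ : b ∈ X) (c∈ : c ∈ X) (d∈ : d ∈ X) (e∈ : e ∈ X) where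

        five = lookup (a ∷ b ∷ c ∷ d ∷ e ∷ [])

        five∈X : ∀ i → five i ∈ X
        five∈X 0F = a∈
        five∈X 1F = b∈
        five∈X 2F = c∈
        five∈X 3F = d∈
        five∈X 4F = e∈

        no-H₁ : Triangle (Agree H₁ five) → ⊥
        no-H₁ tri = no-Q₃ _ (proj₂ (leaves-attached nonCut-H₁ five
          (twinFree⇒injective H₁ five H₁-twinFree ind) five∈X ind))
          where ind = induces H₁ five tri

        no-H₂ : Triangle (Agree H₂ five) → ⊥
        no-H₂ tri = no-Q₄ _ (proj₂ (leaves-attached nonCut-H₂ five
          (twinFree⇒injective H₂ five H₂-twinFree ind) five∈X ind))
          where ind = induces H₂ five tri

        no-C₅ : a ∼ b → b ∼ c → c ∼ d → d ∼ e → e ∼ a →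
                ¬ a ∼ c → ¬ b ∼ d → ¬ c ∼ e → ¬ d ∼ a → ¬ e ∼ b → ⊥
        no-C₅ ab bc cd de ea ac bd ce da eb = no-Q₁ _ (proj₂ (leaves-attached nonCut-C₅ five
          (twinFree⇒injective (C 5) five C₅-twinFree ind) five∈X ind))
          where
          ind = induces (C 5) five
            ( (ab , ac , ≁-sym da , ∼-sym ea , tt) , (bc , bd , ≁-sym eb , tt) , (cd , ce , tt)
            , (de , tt) , tt , tt)

      no-C₄ : ∀ {a b c d} → a ∈ X → b ∈ X → c ∈ X → d ∈ X →
              a ∼ b → b ∼ c → c ∼ d → d ∼ a → a ≢ c → b ≢ d → ¬ a ∼ c → ¬ b ∼ d → ⊥
      no-C₄ {a} {b} {c} {d} a∈ b∈ c∈ d∈ ab bc cd da a≢c b≢d ac bd =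
        no-Q₂ _ (proj₂ (leaves-attached nonCut-C₄ four (λ {i} {j} → inj i j) four∈X
          (induces (C 4) four ((ab , ac , ∼-sym da , tt) , (bc , bd , tt) , (cd , tt) , tt , tt))))
        where
        four = lookup (a ∷ b ∷ c ∷ d ∷ [])

        four∈X : ∀ i → four i ∈ X
        four∈X 0F = a∈
        four∈X 1F = b∈
        four∈X 2F = c∈
        four∈X 3F = d∈

        apart : ∀ {i j : Fin 4} {x y : Fin n} → x ≢ y → x ≡ y → i ≡ j
        apart x≢y x≡y = contradiction x≡y x≢y

        -- Opposite vertices of `C 4` are twins, so injectivity rests on `a ≢ c` and `b ≢ d`.
        inj : ∀ i j → four i ≡ four j → i ≡ j
        inj = triangle (λ _ _ → refl) (λ h → sym ∘ h ∘ sym)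
          ( (apart (∼⇒≢ ab) , apart a≢c , apart (∼⇒≢ da ∘ sym) , tt)
          , (apart (∼⇒≢ bc) , apart b≢d , tt) , (apart (∼⇒≢ cd) , tt) , tt , tt)

      module _ {x y a b} (x∈ : x ∈ X) (y∈ : y ∈ X) (a∈ : a ∈ X) (b∈ : b ∈ X) (x∼y : x ∼ y) (a∼b : a ∼ b)
               (x≁a : ¬ x ∼ a) (x≁b : ¬ x ∼ b) (y≁a : ¬ y ∼ a) (y≁b : ¬ y ∼ b) where

        -- If both ends of the edge `x y` see `k`, then `x`, `y`, `k`, `p`, `q` induce H₁; if only
        -- one does, they induce P₅.
        far-edge : ∀ {k p q} → k ∈ X → p ∈ X → q ∈ X → x ∼ k ⊎ y ∼ k → k ∼ p → p ∼ q → ¬ k ∼ q →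
                   ¬ x ∼ p → ¬ y ∼ p → ¬ x ∼ q → ¬ y ∼ q → ⊥
        far-edge {k} k∈ p∈ q∈ touch kp pq kq xp yp xq yq with x ∼? k | y ∼? k
        ... | yes xk | yes yk = no-H₁ k∈ x∈ y∈ p∈ q∈
                ((∼-sym xk , ∼-sym yk , kp , kq , tt) , (x∼y , xp , xq , tt) , (yp , yq , tt) , (pq , tt) , tt , tt)
        ... | yes xk | no yk  = no-P₅ y∈ x∈ k∈ p∈ q∈ (∼-sym x∼y) xk kp pq yk yp yq xp xq kq
        ... | no xk  | yes yk = no-P₅ x∈ y∈ k∈ p∈ q∈ x∼y yk kp pq xk xp xq yp yq kq
        ... | no xk  | no yk  = [ xk , yk ]′ touch

        Touches : Fin n → Set
        Touches z = z ≡ x ⊎ z ≡ y ⊎ x ∼ z ⊎ y ∼ z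

        touches? : Decidable Touches
        touches? z = (z ≟ x) ⊎-dec (z ≟ y) ⊎-dec (x ∼? z) ⊎-dec (y ∼? z)

        Near : Fin n → Set
        Near z = Touches z ⊎ ∃ λ k → k ∈ X × Touches k × k ∼ z

        near? : Decidable Near
        near? z = touches? z ⊎-dec any? λ k → (k ∈? X) ×-dec touches? k ×-dec (k ∼? z)

        via : ∀ {k p} → Touches k → k ∼ p → ¬ x ∼ p → ¬ y ∼ p → x ∼ k ⊎ y ∼ k
        via (inj₁ refl)        kp xp yp = contradiction kp xp
        via (inj₂ (inj₁ refl)) kp xp yp = contradiction kp yp
        via (inj₂ (inj₂ t))    kp xp yp = t

        -- Look at how `a` is linked to the edge `x y`. Through one vertex `k` that misses `b`,
        -- `far-edge` applies; if `k` sees `b`, there is H₂ or H₁, depending on whether `k` sees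
        -- both of `x` and `y`. If `a` is farther away, a walk in `X` contains an edge `p q` to
        -- which `far-edge` applies.
        no-2K₂ : ⊥
        no-2K₂ with near? a
        ... | yes (inj₁ (inj₁ refl))               = x≁b a∼b
        ... | yes (inj₁ (inj₂ (inj₁ refl)))        = y≁b a∼b
        ... | yes (inj₁ (inj₂ (inj₂ (inj₁ x∼a)))) = x≁a x∼a
        ... | yes (inj₁ (inj₂ (inj₂ (inj₂ y∼a)))) = y≁a y∼a
        ... | yes (inj₂ (k , k∈ , tk , ka)) with k ∼? b | x ∼? k | y ∼? k
        ...   | no kb  | _      | _      = far-edge k∈ a∈ b∈ (via tk ka x≁a y≁a) ka a∼b kb x≁a y≁a x≁b y≁b
        ...   | yes kb | yes xk | yes yk = no-H₂ k∈ x∈ y∈ a∈ b∈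
                  ( (∼-sym xk , ∼-sym yk , ka , kb , tt) , (x∼y , x≁a , x≁b , tt) , (y≁a , y≁b , tt)
                  , (a∼b , tt) , tt , tt)
        ...   | yes kb | yes xk | no yk  = no-H₁ k∈ a∈ b∈ x∈ y∈
                  ( (ka , kb , ∼-sym xk , ≁-sym yk , tt) , (a∼b , ≁-sym x≁a , ≁-sym y≁a , tt)
                  , (≁-sym x≁b , ≁-sym y≁b , tt) , (x∼y , tt) , tt , tt)
        ...   | yes kb | no xk  | yes yk = no-H₁ k∈ a∈ b∈ y∈ x∈
                  ( (ka , kb , ∼-sym yk , ≁-sym xk , tt) , (a∼b , ≁-sym y≁a , ≁-sym x≁a , tt)
                  , (≁-sym y≁b , ≁-sym x≁b , tt) , (∼-sym x∼y , tt) , tt , tt)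
        ...   | yes kb | no xk  | no yk  = [ xk , yk ]′ (via tk ka x≁a y≁a)
        no-2K₂ | no ¬near with crossing near? (proj₂ connX x a x∈ a∈) (inj₁ (inj₁ refl)) ¬near
        ... | p , q , inj₁ tp , ¬near-q , p∈ , _ , pq = ¬near-q (inj₂ (p , p∈ , tp , pq))
        ... | p , q , inj₂ (k , k∈ , tk , kp) , ¬near-q , p∈ , q∈ , pq with touches? p
        ...   | yes tp = ¬near-q (inj₂ (p , p∈ , tp , pq))
        ...   | no ¬tp = far-edge k∈ p∈ q∈ (via tk kp xp yp) kp pq (λ kq → ¬near-q (inj₂ (k , k∈ , tk , kq)))
                  xp yp (¬near-q ∘ inj₁ ∘ inj₂ ∘ inj₂ ∘ inj₁) (¬near-q ∘ inj₁ ∘ inj₂ ∘ inj₂ ∘ inj₂)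
          where
          xp = ¬tp ∘ inj₂ ∘ inj₂ ∘ inj₁
          yp = ¬tp ∘ inj₂ ∘ inj₂ ∘ inj₂

    cut-core-split : SplitOn X
    cut-core-split = FoldesHammer.foldes-hammer G X no-2K₂ no-C₄ no-C₅

-- The induction on S

module Main {n : ℕ} (G : Graph (Fin n)) (free : 𝓒 -free G) where
  open Graph G
  open Domination G
  open Tails G free
  open CutCore G free

  dominated-walk : ∀ {D A d t} → Conn D → D ⊆ A → d ∈ D → t ∈ A → Dominated D t → Walk A d t
  dominated-walk (_ , walk) D⊆A d∈D t∈A (inj₁ t∈D) = walk-mono D⊆A (walk _ _ d∈D t∈D)
  dominated-walk (_ , walk) D⊆A d∈D t∈A (inj₂ (e , e∈D , t∼e)) =
    walk-mono D⊆A (walk _ _ d∈D e∈D) ◅◅ (D⊆A e e∈D , t∈A , ∼-sym t∼e) ◅ ε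

  module InductionStep (S : VertexSet (Fin n)) (connS : Conn S)
              (ih : ∀ S′ → Conn S′ → ∣ S′ ∣ < ∣ S ∣ → SplitDominated S′) where

    Cut : Fin n → Set
    Cut c = c ∈ S × ¬ Conn (S ⊖ c)

    cut? : Decidable Cut
    cut? c = (c ∈? S) ×-dec ¬? (conn? (S ⊖ c))

    record Avoiding (v : Fin n) : Set where
      field
        D      : VertexSet (Fin n)
        cds    : CDS (S ⊖ v) D
        misses : ¬ Dominated D v
      open CDS cds public

      dominates-rest : ∀ {t} → t ∈ S → t ≢ v → Dominated D t
      dominates-rest t∈S t≢v = dominates _ (∈-⊖⁺ S v t∈S t≢v)

      v≁ : ∀ {d} → d ∈ D → ¬ v ∼ d
      v≁ d∈D v∼d = misses (inj₂ (_ , d∈D , v∼d))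

    avoid : ∀ {v} → v ∈ S → Conn (S ⊖ v) → SplitDominated S ⊎ Avoiding v
    avoid {v} v∈S connS⊖v with ih (S ⊖ v) connS⊖v (∣⊖∣< S v∈S)
    ... | D , cds , split with dominated? D v
    ...   | no misses = inj₂ record { D = D ; cds = cds ; misses = misses }
    ...   | yes dom-v = inj₁ (D , record
      { D⊆S = λ d → proj₁ ∘ ∈-⊖⁻ S v ∘ D⊆S d ; conn = conn ; dominates = dom } , split)
      where
      open CDS cds
      dom : ∀ t → t ∈ S → Dominated D t
      dom t t∈S with t ≟ v
      ... | yes refl = dom-v
      ... | no t≢v   = dominates t (∈-⊖⁺ S v t∈S t≢v)

    -- A set avoiding `v` also avoids its neighbour `x`. Being connected and dominating all of
    -- `S ⊖ v`, it connects `S ⊖ x` apart from `v`, and `v` is attached through `z`; but `x` is a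
    -- cut vertex.
    non-pendant : ∀ {x v z} → Cut x → v ∈ S → Conn (S ⊖ v) → x ∼ v → z ∈ S → v ∼ z → z ≢ x →
                  SplitDominated S
    non-pendant {x} {v} {z} (x∈S , ¬conn) v∈S connS⊖v x∼v z∈S v∼z z≢x with avoid v∈S connS⊖v
    ... | inj₁ good = good
    ... | inj₂ av = contradiction (conn-hub (D⊆S⊖x d d∈D) reach) ¬conn
      where
      open Avoiding av
      d = proj₁ (proj₁ conn)
      d∈D = proj₂ (proj₁ conn)
      D⊆S⊖x : D ⊆ S ⊖ x
      D⊆S⊖x e e∈D = ∈-⊖⁺ S x (proj₁ (∈-⊖⁻ S v (D⊆S e e∈D))) λ { refl → v≁ e∈D (∼-sym x∼v) }
      walk : ∀ {t} → t ∈ S ⊖ x → t ≢ v → Walk (S ⊖ x) d t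
      walk t∈ t≢v = dominated-walk conn D⊆S⊖x d∈D t∈ (dominates-rest (proj₁ (∈-⊖⁻ S x t∈)) t≢v)
      reach : ∀ t → t ∈ S ⊖ x → Walk (S ⊖ x) d t
      reach t t∈ with t ≟ v
      ... | no t≢v   = walk t∈ t≢v
      ... | yes refl = walk z∈ (∼⇒≢ v∼z ∘ sym) ◅◅ (z∈ , t∈ , ∼-sym v∼z) ◅ ε
        where z∈ = ∈-⊖⁺ S x z∈S z≢x

    -- If every non-cut vertex next to a cut vertex is pendant, the cut vertices form a
    -- connected dominating set.
    cut-vertices : ∀ {c} → Cut c →
                   (∀ {x v z} → Cut x → v ∈ S → Conn (S ⊖ v) → x ∼ v → z ∈ S → v ∼ z → z ≡ x) →
                   SplitDominated S
    cut-vertices {c} cut-c pendant = X , record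
      { D⊆S = X⊆S ; conn = connX ; dominates = dom } ,
      cut-core-split connS X⊆S connX λ x x∈X → proj₂ (⟪⟫⁻ cut? x∈X)
      where
      X = ⟪ cut? ⟫
      X⊆S : X ⊆ S
      X⊆S x x∈X = proj₁ (⟪⟫⁻ cut? x∈X)
      c∈X = ⟪⟫⁺ cut? cut-c

      Reached : Fin n → Set
      Reached t = Walk X c t × t ∈ X ⊎ t ∉ X × ∃ λ x → x ∈ X × Walk X c x × x ∼ t

      step : ∀ {y z} → Reached y → Edge S y z → Reached z
      step {y} {z} (inj₁ (w , y∈X)) (_ , _ , y∼z) with z ∈? X
      ... | yes z∈X = inj₁ (w ◅◅ (y∈X , z∈X , y∼z) ◅ ε , z∈X)
      ... | no z∉X  = inj₂ (z∉X , y , y∈X , w , y∼z)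
      step {y} {z} (inj₂ (y∉X , x , x∈X , w , x∼y)) (y∈S , z∈S , y∼z)
        with pendant (⟪⟫⁻ cut? x∈X) y∈S
               (decidable-stable (conn? (S ⊖ y)) λ ¬conn → y∉X (⟪⟫⁺ cut? (y∈S , ¬conn))) x∼y z∈S y∼z
      ... | refl = inj₁ (w , x∈X)

      reached : ∀ t → t ∈ S → Reached t
      reached t t∈S = walk-invariant Reached step (inj₁ (ε , c∈X)) (proj₂ connS c t (proj₁ cut-c) t∈S)

      connX : Conn X
      connX = conn-hub c∈X λ t t∈X →
        [ proj₁ , (λ (t∉X , _) → contradiction t∈X t∉X) ]′ (reached t (X⊆S t t∈X))

      dom : ∀ t → t ∈ S → Dominated X t
      dom t t∈S = [ inj₁ ∘ proj₂ , (λ (_ , x , x∈X , _ , x∼t) → inj₂ (x , x∈X , ∼-sym x∼t)) ]′ (reached t t∈S)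

    no-cut-vertices : (∀ v → v ∈ S → Conn (S ⊖ v)) → SplitDominated S
    no-cut-vertices non-cut = start (proj₁ connS)
      where
      module _ {v : Fin n} (v∈S : v ∈ S) (av : Avoiding v) {u : Fin n} (u∈S : u ∈ S) (v∼u : v ∼ u) where
        private
          module A = Avoiding av
          d = proj₁ (proj₁ A.conn)
          d∈D = proj₂ (proj₁ A.conn)

        kept? : Decidable λ s → s ∈ S × (v ∼ s → s ≡ u)
        kept? s = (s ∈? S) ×-dec ((v ∼? s) →-dec (s ≟ u))

        S′ : VertexSet (Fin n)
        S′ = ⟪ kept? ⟫

        S′⊆S : S′ ⊆ S
        S′⊆S s s∈ = proj₁ (⟪⟫⁻ kept? s∈)

        N[v] : ∀ {s} → s ∈ S′ → v ∼ s → s ≡ u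
        N[v] s∈ = proj₂ (⟪⟫⁻ kept? s∈)

        removed : ∀ {s} → s ∈ S → s ∉ S′ → v ∼ s
        removed {s} s∈S s∉ = decidable-stable (v ∼? s) λ v≁s →
          s∉ (⟪⟫⁺ kept? (s∈S , λ v∼s → contradiction v∼s v≁s))

        v∈S′ : v ∈ S′
        v∈S′ = ⟪⟫⁺ kept? (v∈S , λ v∼v → contradiction v∼v (∼-irrefl refl))

        u∈S′ : u ∈ S′
        u∈S′ = ⟪⟫⁺ kept? (u∈S , λ _ → refl)

        D⊆S′ : A.D ⊆ S′
        D⊆S′ e e∈D = ⟪⟫⁺ kept? (proj₁ (∈-⊖⁻ S v (A.D⊆S e e∈D)) , λ v∼e → contradiction v∼e (A.v≁ e∈D))

        -- The avoiding set contains no neighbour of `v`, so it survives in `S′`. It dominates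
        -- everything there except `v`, which hangs on `u`.
        connS′ : Conn S′
        connS′ = conn-hub (D⊆S′ d d∈D) reach
          where
          walk : ∀ {t} → t ∈ S′ → t ≢ v → Walk S′ d t
          walk t∈ t≢v = dominated-walk A.conn D⊆S′ d∈D t∈ (A.dominates-rest (S′⊆S _ t∈) t≢v)
          reach : ∀ t → t ∈ S′ → Walk S′ d t
          reach t t∈ with t ≟ v
          ... | no t≢v   = walk t∈ t≢v
          ... | yes refl = walk u∈S′ (∼⇒≢ v∼u ∘ sym) ◅◅ (u∈S′ , v∈S′ , ∼-sym v∼u) ◅ ε

        -- Since `u` is not a cut vertex, `v` has a neighbour in `S ⊖ u`, and this neighbour is
        -- dropped from `S′`.
        smaller : ∣ S′ ∣ < ∣ S ∣
        smaller with neighbour (non-cut u u∈S) (∈-⊖⁺ S u v∈S (∼⇒≢ v∼u))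
                       (∈-⊖⁺ S u (proj₁ (∈-⊖⁻ S v (A.D⊆S d d∈D))) λ { refl → A.v≁ d∈D v∼u })
                       (proj₂ (∈-⊖⁻ S v (A.D⊆S d d∈D)))
        ... | y , y∈S⊖u , v∼y = let y∈S , y≢u = ∈-⊖⁻ S u y∈S⊖u in
          ∣∣-mono-< S S′⊆S (λ y∈S′ → y≢u (N[v] y∈S′ v∼y)) y∈S

        module _ {D′ : VertexSet (Fin n)} (cds : CDS S′ D′) (split : SplitOn D′) where
          open CDS cds
          open SplitOn split

          D′⊆S : D′ ⊆ S
          D′⊆S t t∈ = S′⊆S t (D⊆S t t∈)

          all-dominated : (∀ t → t ∈ S → Dominated D′ t) → SplitDominated S
          all-dominated dom = D′ , record { D⊆S = D′⊆S ; conn = conn ; dominates = dom } , split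

          -- All the vertices dropped from `S` are neighbours of `v`.
          v∈D′⇒all-dominated : v ∈ D′ → ∀ t → t ∈ S → Dominated D′ t
          v∈D′⇒all-dominated v∈D′ t t∈S with t ∈? S′
          ... | yes t∈S′ = dominates t t∈S′
          ... | no t∉S′  = inj₂ (v , v∈D′ , ∼-sym (removed t∈S t∉S′))

          v∉D′⇒u∈D′ : v ∉ D′ → u ∈ D′
          v∉D′⇒u∈D′ v∉D′ with dominates v v∈S′
          ... | inj₁ v∈D′ = contradiction v∈D′ v∉D′
          ... | inj₂ (e , e∈D′ , v∼e) = subst (_∈ D′) (N[v] (D⊆S e e∈D′) v∼e) e∈D′

          module _ (v∉D′ : v ∉ D′) {w : Fin n} (w∈S : w ∈ S) (w≁D′ : ¬ Dominated D′ w) where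
            u∈D′ = v∉D′⇒u∈D′ v∉D′

            E : VertexSet (Fin n)
            E = D′ ⊕ v

            v≁ : ∀ {t} → t ∈ D′ → t ≢ u → ¬ v ∼ t
            v≁ t∈D′ t≢u = t≢u ∘ N[v] (D⊆S _ t∈D′)

            cds-E : CDS S E
            cds-E = record
              { D⊆S = λ t → [ D′⊆S t , (λ { refl → v∈S }) ]′ ∘ ∈-⊕⁻ D′ v
              ; conn = conn-hub u∈E λ t → [ (λ t∈D′ → walk-mono (λ _ → ∈-⊕⁺ D′ v) (proj₂ conn u t u∈D′ t∈D′))
                                          , (λ { refl → (u∈E , x∈S⊕x D′ v , ∼-sym v∼u) ◅ ε }) ]′ ∘ ∈-⊕⁻ D′ v
              ; dominates = dom }
              where
              u∈E = ∈-⊕⁺ D′ v u∈D′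
              dom : ∀ t → t ∈ S → Dominated E t
              dom t t∈S with t ∈? S′
              ... | no t∉S′ = inj₂ (v , x∈S⊕x D′ v , ∼-sym (removed t∈S t∉S′))
              ... | yes t∈S′ with dominates t t∈S′
              ...   | inj₁ t∈D′ = inj₁ (∈-⊕⁺ D′ v t∈D′)
              ...   | inj₂ (e , e∈D′ , t∼e) = inj₂ (e , ∈-⊕⁺ D′ v e∈D′ , t∼e)

            -- The only neighbour of `v` in `D′` is `u`, which lies in the clique part, so `v` can
            -- join the stable part. Since `K` may reach beyond `D′`, `v` is removed from it
            -- explicitly.
            split-E : u ∈ K → SplitOn E
            split-E u∈K = record
              { K = K ⊖ v
              ; clique = λ x∈E y∈E x∈ y∈ →
                  let x∈K , x≢v = ∈-⊖⁻ K v x∈ ; y∈K , y≢v = ∈-⊖⁻ K v y∈ in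
                  clique (in-D′ x∈E x≢v) (in-D′ y∈E y≢v) x∈K y∈K
              ; stable = λ x∈E y∈E x∉ y∉ → stab (∈-⊕⁻ D′ v x∈E) (∈-⊕⁻ D′ v y∈E) x∉ y∉ }
              where
              in-D′ : ∀ {x} → x ∈ E → x ≢ v → x ∈ D′
              in-D′ x∈E x≢v = [ id , (λ x≡v → contradiction x≡v x≢v) ]′ (∈-⊕⁻ D′ v x∈E)
              ∉K : ∀ {x} → x ∈ D′ → x ∉ K ⊖ v → x ∉ K
              ∉K x∈D′ x∉ x∈K = x∉ (∈-⊖⁺ K v x∈K λ { refl → v∉D′ x∈D′ })
              v≁∉K : ∀ {x} → x ∈ D′ → x ∉ K ⊖ v → ¬ v ∼ x
              v≁∉K x∈D′ x∉ = v≁ x∈D′ λ { refl → ∉K x∈D′ x∉ u∈K }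
              stab : ∀ {x y} → x ∈ D′ ⊎ x ≡ v → y ∈ D′ ⊎ y ≡ v → x ∉ K ⊖ v → y ∉ K ⊖ v → ¬ x ∼ y
              stab (inj₁ x∈D′) (inj₁ y∈D′) x∉ y∉ = stable x∈D′ y∈D′ (∉K x∈D′ x∉) (∉K y∈D′ y∉)
              stab (inj₁ x∈D′) (inj₂ refl) x∉ y∉ = ≁-sym (v≁∉K x∈D′ x∉)
              stab (inj₂ refl) (inj₁ y∈D′) x∉ y∉ = v≁∉K y∈D′ y∉
              stab (inj₂ refl) (inj₂ refl) x∉ y∉ = ∼-irrefl refl

            -- As `u` is in the stable part, its neighbours in `D′` all lie in the clique part. The
            -- undominated `w` cannot belong to `S′`, so it is one of the dropped neighbours of `v`.
            tail-E : u ∉ K → Tail S E w v u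
            tail-E u∉K = record
              { cds = cds-E ; w∈S = w∈S
              ; w∉D = [ w≁D′ ∘ inj₁ , (λ { refl → w∉S′ v∈S′ }) ]′ ∘ ∈-⊕⁻ D′ v
              ; v∈D = x∈S⊕x D′ v ; u∈D = ∈-⊕⁺ D′ v u∈D′
              ; w∼v = ∼-sym (removed w∈S w∉S′) ; v∼u = v∼u
              ; N[w] = λ t∈E w∼t →
                  [ (λ t∈D′ → contradiction (inj₂ (_ , t∈D′ , w∼t)) w≁D′) , id ]′ (∈-⊕⁻ D′ v t∈E)
              ; N[v] = λ t∈E v∼t → [ (λ t∈D′ → N[v] (D⊆S _ t∈D′) v∼t)
                                   , (λ { refl → contradiction v∼t (∼-irrefl refl) }) ]′ (∈-⊕⁻ D′ v t∈E)
              ; clique = λ p∈E q∈E u∼p u∼q p≢v q≢v →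
                  let p∈D′ = in-D′ p∈E p≢v ; q∈D′ = in-D′ q∈E q≢v in
                  clique p∈D′ q∈D′ (∈K p∈D′ u∼p) (∈K q∈D′ u∼q) }
              where
              w∉S′ : w ∉ S′
              w∉S′ w∈S′ = w≁D′ (dominates w w∈S′)
              in-D′ : ∀ {x} → x ∈ E → x ≢ v → x ∈ D′
              in-D′ x∈E x≢v = [ id , (λ x≡v → contradiction x≡v x≢v) ]′ (∈-⊕⁻ D′ v x∈E)
              ∈K : ∀ {p} → p ∈ D′ → u ∼ p → p ∈ K
              ∈K {p} p∈D′ u∼p = decidable-stable (p ∈? K) λ p∉K → stable u∈D′ p∈D′ u∉K p∉K u∼p

            v-appended : SplitDominated S
            v-appended with u ∈? K
            ... | yes u∈K = E , cds-E , split-E u∈K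
            ... | no u∉K  = tail⇒splitDominated S (tail-E u∉K)

          finish : SplitDominated S
          finish with v ∈? D′ | undominated-or-all D′ S
          ... | yes v∈D′ | _                      = all-dominated (v∈D′⇒all-dominated v∈D′)
          ... | no _     | inj₂ dom               = all-dominated dom
          ... | no v∉D′  | inj₁ (w , w∈S , w≁D′) = v-appended v∉D′ w∈S w≁D′

      start : (∃ λ v → v ∈ S) → SplitDominated S
      start (v , v∈S) with avoid v∈S (non-cut v v∈S)
      ... | inj₁ good = good
      ... | inj₂ av with neighbour connS v∈S (proj₁ (∈-⊖⁻ S v d∈)) (proj₂ (∈-⊖⁻ S v d∈))
        where
        d∈ = Avoiding.D⊆S av _ (proj₂ (proj₁ (Avoiding.conn av)))
      ...   | u , u∈S , v∼u with ih (S′ v∈S av u∈S v∼u) (connS′ v∈S av u∈S v∼u) (smaller v∈S av u∈S v∼u)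
      ...     | D′ , cds , split = finish v∈S av u∈S v∼u cds split

    result : SplitDominated S
    result with any? cut?
    ... | no none = no-cut-vertices λ v v∈S →
            decidable-stable (conn? (S ⊖ v)) λ ¬conn → none (v , v∈S , ¬conn)
    ... | yes (c , cut-c) with any? (λ x → any? λ v → any? λ z → cut? x ×-dec (v ∈? S) ×-dec
              conn? (S ⊖ v) ×-dec (x ∼? v) ×-dec (z ∈? S) ×-dec (v ∼? z) ×-dec ¬? (z ≟ x))
    ...   | yes (x , v , z , cut-x , v∈S , connS⊖v , x∼v , z∈S , v∼z , z≢x) =
            non-pendant cut-x v∈S connS⊖v x∼v z∈S v∼z z≢x
    ...   | no none = cut-vertices cut-c λ {x} {v} {z} cut-x v∈S connS⊖v x∼v z∈S v∼z →
            decidable-stable (z ≟ x) λ z≢x →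
              none (x , v , z , cut-x , v∈S , connS⊖v , x∼v , z∈S , v∼z , z≢x)

  conn⇒splitDominated : ∀ S → Conn S → SplitDominated S
  conn⇒splitDominated S connS = go S connS (<-wellFounded _)
    where
    go : ∀ S → Conn S → Acc _<_ ∣ S ∣ → SplitDominated S
    go S connS (acc rec) = InductionStep.result S connS λ S′ connS′ <S → go S′ connS′ (rec <S)

-- The forbidden graphs have no connected split dominating set

-- The field spread expresses that H [ D ] is connected.
record SplitCDS {W : Set} (H : Graph W) : Set₁ where
  open Graph H
  field
    D         : VertexSet W
    dominates : ∀ x → x ∉ D → ∃ λ d → d ∈ D × x ∼ d
    spread    : (B : W → Set) → (∀ {y z} → B y → z ∈ D → y ∼ z → B z) →
                ∀ {x y} → x ∈ D → B x → y ∈ D → B y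
    K         : W → Set
    K?        : Decidable K
    clique    : ∀ {x y} → x ∈ D → y ∈ D → K x → K y → x ≢ y → x ∼ y
    stable    : ∀ {x y} → x ∈ D → y ∈ D → ¬ K x → ¬ K y → ¬ x ∼ y

module _ {n : ℕ} (G : Graph (Fin n)) (S : VertexSet (Fin n)) {W : Set} (H : Graph W) (iso : (G [ S ]) ≅ H) where
  private
    module H = Graph H
    module GS = Graph (G [ S ])
    open _≅_ iso
    open Inverse vertices using (to; from; strictlyInverseˡ; strictlyInverseʳ)

    to-∼ : ∀ {u v} → u GS.∼ v → to u H.∼ to v
    to-∼ = Equivalence.to (adjacency _ _)

    from-∼ : ∀ {x y} → x H.∼ y → from x GS.∼ from y
    from-∼ {x} {y} x∼y = Equivalence.from (adjacency _ _)
      (subst₂ H._∼_ (sym (strictlyInverseˡ x)) (sym (strictlyInverseˡ y)) x∼y)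

  connected-≅ : Connected H → Connected (G [ S ])
  connected-≅ (x , walk) = from x , λ u v → subst₂ (Star GS._∼_) (strictlyInverseʳ u) (strictlyInverseʳ v)
    (gmap from from-∼ (walk (to u) (to v)))

  splitCDS-≅ : (∃ λ D → Dominating (G [ S ]) D × Connected ((G [ S ]) [ D ]) × Split ((G [ S ]) [ D ])) →
               SplitCDS H
  splitCDS-≅ (D , dom , (_ , walk) , K , clique , stable) = record
    { D = D ∘ from
    ; dominates = λ x x∉D → let u , u∈D , x∼u = dom (from x) x∉D in
        to u , subst (_∈ D) (sym (strictlyInverseʳ u)) u∈D ,
        subst (H._∼ to u) (strictlyInverseˡ x) (to-∼ x∼u)
    ; spread = λ B step {x} {y} x∈D bx y∈D → subst B (strictlyInverseˡ y)
        (follow B step (walk (from x , x∈D) (from y , y∈D)) (subst B (sym (strictlyInverseˡ x)) bx))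
    -- The given clique part lives on the vertices of the dominating set only, hence the membership
    -- proof packed into it.
    ; K = λ x → ∃ λ x∈D → (from x , x∈D) ∈ K
    ; K? = K?
    ; clique = λ {x} {y} x∈D y∈D (x∈D′ , x∈K) (y∈D′ , y∈K) x≢y →
        subst₂ H._∼_ (strictlyInverseˡ x) (strictlyInverseˡ y) (to-∼
          (clique (from x , x∈D′) (from y , y∈D′) x∈K y∈K λ eq → x≢y
            (trans (sym (strictlyInverseˡ x)) (trans (cong (to ∘ proj₁) eq) (strictlyInverseˡ y)))))
    ; stable = λ {x} {y} x∈D y∈D x∉K y∉K x∼y →
        stable (from x , x∈D) (from y , y∈D) (λ x∈K → x∉K (x∈D , x∈K)) (λ y∈K → y∉K (y∈D , y∈K)) (from-∼ x∼y)
    }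
    where
    K? : Decidable λ x → ∃ λ x∈D → (from x , x∈D) ∈ K
    K? x with from x ∈? D
    ... | no x∉D  = no (x∉D ∘ proj₁)
    ... | yes x∈D = map′ (x∈D ,_)
      (λ (x∈D′ , x∈K) → subst (λ p → (from x , p) ∈ K) (T-irrelevant x∈D′ x∈D) x∈K)
      ((from x , x∈D) ∈? K)

    follow : (B : W → Set) → (∀ {y z} → B y → from z ∈ D → y H.∼ z → B z) →
             ∀ {p q} → Star (Graph._∼_ ((G [ S ]) [ D ])) p q → B (to (proj₁ p)) → B (to (proj₁ q))
    follow B step ε bp = bp
    follow B step (_◅_ {j = q} p∼q w) bp = follow B step w
      (step bp (subst (_∈ D) (sym (strictlyInverseʳ (proj₁ q))) (proj₂ q)) (to-∼ p∼q))

module NonSplit {W : Set} {H : Graph W} (cds : SplitCDS H) where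
  open Graph H
  open SplitCDS cds

  K-end : ∀ {x y} → x ∈ D → y ∈ D → x ∼ y → ¬ K x → K y
  K-end {y = y} x∈D y∈D x∼y x∉K = decidable-stable (K? y) λ y∉K → stable x∈D y∈D x∉K y∉K x∼y

  -- The vertex z serves to tell x and y apart.
  not-both-K : ∀ {x y z} → x ∈ D → y ∈ D → ¬ x ∼ y → z ∼ x → ¬ z ∼ y → K x → ¬ K y
  not-both-K x∈D y∈D x≁y z∼x z≁y x∈K y∈K = x≁y (clique x∈D y∈D x∈K y∈K λ { refl → z≁y z∼x })

  -- Each of the two edges has an end in the clique part, and these ends would have to be adjacent.
  no-2K₂ : ∀ {x y a b} → x ∈ D → y ∈ D → a ∈ D → b ∈ D → x ∼ y → a ∼ b →
           ¬ x ∼ a → ¬ x ∼ b → ¬ y ∼ a → ¬ y ∼ b → ⊥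
  no-2K₂ {x} {y} {a} {b} x∈ y∈ a∈ b∈ x∼y a∼b x≁a x≁b y≁a y≁b with K? x
  ... | yes x∈K = not-both-K x∈ b∈ x≁b (∼-sym x∼y) y≁b x∈K
                    (K-end a∈ b∈ a∼b (not-both-K x∈ a∈ x≁a (∼-sym x∼y) y≁a x∈K))
  ... | no x∉K  = not-both-K y∈ b∈ y≁b x∼y x≁b y∈K
                    (K-end a∈ b∈ a∼b (not-both-K y∈ a∈ y≁a x∼y x≁a y∈K))
    where y∈K = K-end x∈ y∈ x∼y x∉K

  -- One of `a`, `c` is outside the clique part, which forces both of its neighbours `b` and `d`
  -- into it.
  no-C₄ : ∀ {a b c d} → a ∈ D → b ∈ D → c ∈ D → d ∈ D → a ∼ b → b ∼ c → c ∼ d → d ∼ a →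
          a ≢ c → b ≢ d → ¬ a ∼ c → ¬ b ∼ d → ⊥
  no-C₄ {a} {b} {c} {d} a∈ b∈ c∈ d∈ a∼b b∼c c∼d d∼a a≢c b≢d a≁c b≁d with K? a
  ... | no a∉K  = b≁d (clique b∈ d∈ (K-end a∈ b∈ a∼b a∉K) (K-end a∈ d∈ (∼-sym d∼a) a∉K) b≢d)
  ... | yes a∈K = b≁d (clique b∈ d∈ (K-end c∈ b∈ (∼-sym b∼c) c∉K) (K-end c∈ d∈ c∼d c∉K) b≢d)
    where c∉K = λ c∈K → a≁c (clique a∈ c∈ a∈K c∈K a≢c)

  -- If `a` is in the clique part, the adjacent vertices `c` and `d` are both outside it; if not,
  -- the non-adjacent `b` and `e` are both inside.
  no-C₅ : ∀ {a b c d e} → a ∈ D → b ∈ D → c ∈ D → d ∈ D → e ∈ D →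
          a ∼ b → b ∼ c → c ∼ d → d ∼ e → e ∼ a →
          ¬ a ∼ c → ¬ b ∼ d → ¬ c ∼ e → ¬ d ∼ a → ¬ e ∼ b → ⊥
  no-C₅ {a} a∈ b∈ c∈ d∈ e∈ a∼b b∼c c∼d d∼e e∼a a≁c b≁d c≁e d≁a e≁b with K? a
  ... | yes a∈K = stable c∈ d∈ (not-both-K a∈ c∈ a≁c e∼a (c≁e ∘ ∼-sym) a∈K)
                    (not-both-K a∈ d∈ (d≁a ∘ ∼-sym) (∼-sym a∼b) b≁d a∈K) c∼d
  ... | no a∉K  = not-both-K b∈ e∈ (e≁b ∘ ∼-sym) (∼-sym b∼c) c≁e
                    (K-end a∈ b∈ a∼b a∉K) (K-end a∈ e∈ (∼-sym e∼a) a∉K)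

Traceable : ∀ {m} → Graph (Fin m) → Fin m × List (Fin m) → Set
Traceable H (j , js) = Linked (Graph._∼_ H) (j ∷ js) × ∀ x → x ∈ˡ j ∷ js

traceable? : ∀ {m} (H : Graph (Fin m)) r → Dec (Traceable H r)
traceable? H (j , js) = linked? (Graph._∼?_ H) (j ∷ js) ×-dec all? λ x → x ∈ˡ? j ∷ js
  where open DecMembership _≟_ using () renaming (_∈?_ to _∈ˡ?_)

traceable⇒connected : ∀ {m} (H : Graph (Fin m)) {r} → Traceable H r → Connected H
traceable⇒connected H {j , js} (linked , covers) = j , λ x y →
  reverse ∼-sym (All.lookup (along linked) (covers x)) ◅◅ All.lookup (along linked) (covers y)
  where
  open Graph H
  along : ∀ {i is} → Linked _∼_ (i ∷ is) → All (Star _∼_ i) (i ∷ is)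
  along [-]        = ε ∷ []
  along (i∼k ∷ ks) = ε ∷ All.map (i∼k ◅_) (along ks)

attachLeaves-connected : ∀ {m k} (H : Graph (Fin m)) (us : Vec (Fin m) k) →
                         Connected H → Connected (attachLeaves H us)
attachLeaves-connected {m} {k} H us (root , walk) =
  inj₁ root , λ x y → inward x ◅◅ gmap inj₁ id (walk (base x) (base y)) ◅◅ reverse (λ {x} {y} → ∼-sym {x} {y}) (inward y)
  where
  open Graph (attachLeaves H us)
  base : Fin m ⊎ Fin k → Fin m
  base = [ id , lookup us ]′
  inward : ∀ x → Star _∼_ x (inj₁ (base x))
  inward (inj₁ _) = ε
  inward (inj₂ _) = refl ◅ ε

module _ {m k} (H : Graph (Fin m)) (us : Vec (Fin m) k) (cds : SplitCDS (attachLeaves H us)) where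
  open SplitCDS cds

  -- If the base is missing, its leaf must be in `D`, and connectedness confines `D` to that leaf
  -- alone. Then the second leaf `j` is neither in `D` nor dominated.
  base∈D : ∀ i → (∃ λ j → j ≢ i) → inj₁ (lookup us i) ∈ D
  base∈D i (j , j≢i) = decidable-stable (inj₁ (lookup us i) ∈? D) impossible
    where
    impossible : ¬ inj₁ (lookup us i) ∉ D
    impossible base∉D = conclude (inj₂ j ∈? D)
      where
      leaf∈D : inj₂ i ∈ D
      leaf∈D = decidable-stable (inj₂ i ∈? D) λ leaf∉D → case (dominates (inj₂ i) leaf∉D)
        where
        case : ¬ ∃ λ d → d ∈ D × Graph._∼_ (attachLeaves H us) (inj₂ i) d
        case (inj₁ _ , d∈D , refl) = base∉D d∈D

      alone : ∀ {x} → x ∈ D → x ≡ inj₂ i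
      alone = spread (_≡ inj₂ i)
        (λ { {z = inj₁ _} refl z∈D refl → contradiction z∈D base∉D ; {z = inj₂ _} refl _ () }) leaf∈D refl

      conclude : Dec (inj₂ j ∈ D) → ⊥
      conclude (yes j∈D) with alone j∈D
      ... | refl = j≢i refl
      conclude (no j∉D) with dominates (inj₂ j) j∉D
      ... | inj₁ _ , d∈D , _ with alone d∈D
      ...   | ()

Q₁-undominated : ¬ SplitCDS Q₁
Q₁-undominated cds = NonSplit.no-C₅ cds
  (inD 0F (1F , λ ())) (inD 1F (0F , λ ())) (inD 2F (0F , λ ())) (inD 3F (0F , λ ())) (inD 4F (0F , λ ()))
  (from-yes (0F ∼? 1F)) (from-yes (1F ∼? 2F)) (from-yes (2F ∼? 3F)) (from-yes (3F ∼? 4F)) (from-yes (4F ∼? 0F))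
  (from-yes (¬? (0F ∼? 2F))) (from-yes (¬? (1F ∼? 3F))) (from-yes (¬? (2F ∼? 4F)))
  (from-yes (¬? (3F ∼? 0F))) (from-yes (¬? (4F ∼? 1F)))
  where
  open Graph (C 5)
  inD = base∈D (C 5) (allFin 5) cds

Q₂-undominated : ¬ SplitCDS Q₂
Q₂-undominated cds = NonSplit.no-C₄ cds
  (inD 0F (1F , λ ())) (inD 1F (0F , λ ())) (inD 2F (0F , λ ())) (inD 3F (0F , λ ()))
  (from-yes (0F ∼? 1F)) (from-yes (1F ∼? 2F)) (from-yes (2F ∼? 3F)) (from-yes (3F ∼? 0F))
  (λ ()) (λ ()) (from-yes (¬? (0F ∼? 2F))) (from-yes (¬? (1F ∼? 3F)))
  where
  open Graph (C 4)
  inD = base∈D (C 4) (allFin 4) cds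

Q₃-undominated : ¬ SplitCDS Q₃
Q₃-undominated cds = NonSplit.no-2K₂ cds b∈D (inD 1F (0F , λ ())) d∈D e∈D
  (from-yes (1F ∼? 2F)) (from-yes (3F ∼? 4F))
  (from-yes (¬? (1F ∼? 3F))) (from-yes (¬? (1F ∼? 4F))) (from-yes (¬? (2F ∼? 3F))) (from-yes (¬? (2F ∼? 4F)))
  where
  open Graph H₁
  open SplitCDS cds
  inD = base∈D H₁ (1F ∷ 2F ∷ 4F ∷ []) cds
  b∈D = inD 0F (1F , λ ())
  e∈D = inD 2F (0F , λ ())

  e-only-d : ∀ x → 4F ∼ x → x ≡ 3F
  e-only-d = from-yes (all? λ x → (4F ∼? x) →-dec (x ≟ 3F))

  -- Without `d`, a walk in `D` starting at `e` is trapped in `e` and its leaf and never gets to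
  -- `b`.
  d∈D : inj₁ 3F ∈ D
  d∈D = decidable-stable (inj₁ 3F ∈? D) λ d∉D → case spread (λ x → x ≡ inj₁ 4F ⊎ x ≡ inj₂ 2F)
      (λ { {z = inj₁ z} (inj₁ refl) z∈D e∼z → contradiction (subst (λ z → inj₁ z ∈ D) (e-only-d z e∼z) z∈D) d∉D
         ; {z = inj₂ 0F} (inj₁ refl) _ ()
         ; {z = inj₂ 1F} (inj₁ refl) _ ()
         ; {z = inj₂ 2F} (inj₁ refl) _ _    → inj₂ refl
         ; {z = inj₁ _}  (inj₂ refl) _ refl → inj₁ refl
         ; {z = inj₂ _}  (inj₂ refl) _ () })
      e∈D (inj₁ refl) b∈D of λ { (inj₁ ()) ; (inj₂ ()) }

Q₄-undominated : ¬ SplitCDS Q₄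
Q₄-undominated cds = NonSplit.no-2K₂ cds
  (inD 0F (1F , λ ())) (inD 1F (0F , λ ())) (inD 2F (0F , λ ())) (inD 3F (0F , λ ()))
  (from-yes (1F ∼? 2F)) (from-yes (3F ∼? 4F))
  (from-yes (¬? (1F ∼? 3F))) (from-yes (¬? (1F ∼? 4F))) (from-yes (¬? (2F ∼? 3F))) (from-yes (¬? (2F ∼? 4F)))
  where
  open Graph H₂
  inD = base∈D H₂ (1F ∷ 2F ∷ 3F ∷ 4F ∷ []) cds

P₇-undominated : ¬ SplitCDS (P 7)
P₇-undominated cds = NonSplit.no-2K₂ cds
  (inner 1F (s≤s z≤n) (s≤s z≤n)) (inner 2F (s≤s z≤n) (s≤s (s≤s z≤n)))
  (inner 4F (s≤s z≤n) (s≤s (s≤s (s≤s (s≤s z≤n))))) (inner 5F (s≤s z≤n) ℕ.≤-refl)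
  (from-yes (1F ∼? 2F)) (from-yes (4F ∼? 5F))
  (from-yes (¬? (1F ∼? 4F))) (from-yes (¬? (1F ∼? 5F))) (from-yes (¬? (2F ∼? 4F))) (from-yes (¬? (2F ∼? 5F)))
  where
  open Graph (P 7)
  open SplitCDS cds

  step-below : ∀ i y z → y Fin.< i → y ∼ z → z ≡ i ⊎ z Fin.< i
  step-below = from-yes (all? λ i → all? λ y → all? λ z →
    (y Fin.<? i) →-dec ((y ∼? z) →-dec ((z ≟ i) ⊎-dec (z Fin.<? i))))

  only-1 : ∀ x → 0F ∼ x → x ≡ 1F
  only-1 = from-yes (all? λ x → (0F ∼? x) →-dec (x ≟ 1F))

  only-5 : ∀ x → 6F ∼ x → x ≡ 5F
  only-5 = from-yes (all? λ x → (6F ∼? x) →-dec (x ≟ 5F))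

  low : ∃ λ x → x ∈ D × toℕ x ≤ 1
  low with 0F ∈? D
  ... | yes 0∈D = 0F , 0∈D , z≤n
  ... | no 0∉D with dominates 0F 0∉D
  ...   | x , x∈D , 0∼x = x , x∈D , ℕ.≤-reflexive (cong toℕ (only-1 x 0∼x))

  high : ∃ λ x → x ∈ D × 5 ≤ toℕ x
  high with 6F ∈? D
  ... | yes 6∈D = 6F , 6∈D , ℕ.n≤1+n 5
  ... | no 6∉D with dominates 6F 6∉D
  ...   | x , x∈D , 6∼x = x , x∈D , ℕ.≤-reflexive (sym (cong toℕ (only-5 x 6∼x)))

  -- Dominating the two ends forces vertices of `D` at positions at most 1 and at least 5; a gap
  -- between them would disconnect `D`.
  inner : ∀ i → 1 ≤ toℕ i → toℕ i ≤ 5 → i ∈ D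
  inner i 1≤i i≤5 = decidable-stable (i ∈? D) λ i∉D →
    let p , p∈D , p≤1 = low
        q , q∈D , 5≤q = high
        ≢i : ∀ {x} → x ∈ D → toℕ x ≢ toℕ i
        ≢i x∈D eq = i∉D (subst (_∈ D) (toℕ-injective eq) x∈D)
        below : ∀ {y z} → y Fin.< i → z ∈ D → y ∼ z → z Fin.< i
        below y<i z∈D y∼z = [ (λ { refl → contradiction z∈D i∉D }) , id ]′ (step-below i _ _ y<i y∼z)
    in ℕ.<⇒≱ (spread (Fin._< i) below p∈D (ℕ.≤∧≢⇒< (ℕ.≤-trans p≤1 1≤i) (≢i p∈D)) q∈D) (ℕ.≤-trans i≤5 5≤q)

-- turn σ i k is the k-th vertex after i in one of the two directions around C₇.
turn : Fin 2 → Fin 7 → ℕ → Fin 7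
turn σ i k = (toℕ i + (1 + 5 * toℕ σ) * k) mod 7

-- An arc holds `1 + toℕ l` vertices, from one to four, and starts next to `i`. For `σ = 1F` the
-- factor in `turn` is 6, which is -1 modulo 7.
Arc : Fin 2 → Fin 7 → Fin 4 → Fin 7 → Set
Arc σ i l x = ∃ λ (t : Fin 4) → t Fin.≤ l × x ≡ turn σ i (1 + toℕ t)

arc? : ∀ σ i l → Decidable (Arc σ i l)
arc? σ i l x = any? λ (t : Fin 4) → (t Fin.≤? l) ×-dec (x ≟ turn σ i (1 + toℕ t))

module _ where
  open Graph (C 7)

  arc-closed : ∀ σ i l y z → Arc σ i l y → y ∼ z → Arc σ i l z ⊎ z ≡ i ⊎ z ≡ turn σ i (2 + toℕ l)
  arc-closed = from-yes (all? λ σ → all? λ i → all? λ l → all? λ y → all? λ z →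
    arc? σ i l y →-dec ((y ∼? z) →-dec (arc? σ i l z ⊎-dec (z ≟ i) ⊎-dec (z ≟ turn σ i (2 + toℕ l)))))

  -- The arc ends at position `1 + toℕ l`. Position `3 + toℕ l` is at most 6, so going on from there
  -- leads at most back to `i` and not into the arc.
  arc-far : ∀ σ i l → ¬ Arc σ i l (turn σ i (3 + toℕ l)) ×
            (∀ x → turn σ i (3 + toℕ l) ∼ x → ¬ Arc σ i l x)
  arc-far = from-yes (all? λ σ → all? λ i → all? λ l → ¬? (arc? σ i l (turn σ i (3 + toℕ l))) ×-dec
    all? λ x → (turn σ i (3 + toℕ l) ∼? x) →-dec ¬? (arc? σ i l x))

  neighbours-C₇ : ∀ i x → i ∼ x → ∃ λ σ → x ≡ turn σ i 1
  neighbours-C₇ = from-yes (all? λ i → all? λ x → (i ∼? x) →-dec any? λ σ → x ≟ turn σ i 1)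

  2K₂-C₇ : ∀ σ i → let x = turn σ i 1 ; y = turn σ i 2 ; a = turn σ i 4 ; b = turn σ i 5 in
           x ∼ y × a ∼ b × ¬ x ∼ a × ¬ x ∼ b × ¬ y ∼ a × ¬ y ∼ b
  2K₂-C₇ = from-yes (all? λ σ → all? λ i →
    let x = turn σ i 1 ; y = turn σ i 2 ; a = turn σ i 4 ; b = turn σ i 5 in
    (x ∼? y) ×-dec (a ∼? b) ×-dec ¬? (x ∼? a) ×-dec ¬? (x ∼? b) ×-dec ¬? (y ∼? a) ×-dec ¬? (y ∼? b))

C₇-undominated : ¬ SplitCDS (C 7)
C₇-undominated cds = by-cases (any? λ i → ¬? (i ∈? D))
  where
  open SplitCDS cds

  two-edges : ∀ σ i → turn σ i 1 ∈ D → turn σ i 2 ∈ D → turn σ i 4 ∈ D → turn σ i 5 ∈ D → ⊥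
  two-edges σ i x∈ y∈ a∈ b∈ = let xy , ab , xa , xb , ya , yb = 2K₂-C₇ σ i in
    NonSplit.no-2K₂ cds x∈ y∈ a∈ b∈ xy ab xa xb ya yb

  -- Otherwise D stays within an arc of at most four vertices and does not dominate a vertex beyond it.
  next∈D : ∀ σ i → i ∉ D → turn σ i 1 ∈ D → ∀ l → turn σ i (2 + toℕ l) ∈ D
  next∈D σ i i∉D first l = decidable-stable (turn σ i (2 + toℕ l) ∈? D) impossible
    where
    far = turn σ i (3 + toℕ l)
    impossible : ¬ turn σ i (2 + toℕ l) ∉ D
    impossible last∉D = missed (far ∈? D)
      where
      within : ∀ {x} → x ∈ D → Arc σ i l x
      within = spread (Arc σ i l)
        (λ {y} {z} y∈Arc z∈D y∼z →
          [ id , [ (λ { refl → contradiction z∈D i∉D }) , (λ { refl → contradiction z∈D last∉D }) ]′ ]′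
            (arc-closed σ i l y z y∈Arc y∼z))
        first (0F , z≤n , refl)
      missed : ¬ Dec (far ∈ D)
      missed (yes far∈D) = proj₁ (arc-far σ i l) (within far∈D)
      missed (no far∉D) = let x , x∈D , far∼x = dominates far far∉D in
        proj₂ (arc-far σ i l) x far∼x (within x∈D)

  by-cases : ¬ Dec (∃ λ i → i ∉ D)
  by-cases (no full) = two-edges 0F 0F (all∈D _) (all∈D _) (all∈D _) (all∈D _)
    where all∈D = none⇒all (_∈? D) full
  by-cases (yes (i , i∉D)) with dominates i i∉D
  ... | x , x∈D , i∼x with neighbours-C₇ i x i∼x
  -- `next l` concerns position `2 + toℕ l`, so these are positions 1, 2, 4 and 5 after `i`.
  ...   | σ , refl = two-edges σ i x∈D (next 0F) (next 2F) (next 3F)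
    where next = next∈D σ i i∉D x∈D

𝓒-connected : All (λ H → Connected (proj₂ H)) 𝓒
𝓒-connected =
    traceable⇒connected (P 7) (from-yes (traceable? (P 7) (0F , 1F ∷ 2F ∷ 3F ∷ 4F ∷ 5F ∷ 6F ∷ [])))
  ∷ traceable⇒connected (C 7) (from-yes (traceable? (C 7) (0F , 1F ∷ 2F ∷ 3F ∷ 4F ∷ 5F ∷ 6F ∷ [])))
  ∷ attachLeaves-connected (C 5) _ (traceable⇒connected (C 5) (from-yes (traceable? (C 5) (0F , 1F ∷ 2F ∷ 3F ∷ 4F ∷ []))))
  ∷ attachLeaves-connected (C 4) _ (traceable⇒connected (C 4) (from-yes (traceable? (C 4) (0F , 1F ∷ 2F ∷ 3F ∷ []))))
  ∷ attachLeaves-connected H₁ _ (traceable⇒connected H₁ (from-yes (traceable? H₁ (1F , 2F ∷ 0F ∷ 3F ∷ 4F ∷ []))))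
  ∷ attachLeaves-connected H₂ _ (traceable⇒connected H₂ (from-yes (traceable? H₂ (1F , 2F ∷ 0F ∷ 3F ∷ 4F ∷ []))))
  ∷ []

𝓒-undominated : All (λ H → ¬ SplitCDS (proj₂ H)) 𝓒
𝓒-undominated =
  P₇-undominated ∷ C₇-undominated ∷ Q₁-undominated ∷ Q₂-undominated ∷ Q₃-undominated ∷ Q₄-undominated ∷ []

-- Translation between induced subgraphs and vertex sets, and the equivalence

module _ {n : ℕ} (G : Graph (Fin n)) where
  open Graph G
  open Domination G

  connected⇒conn : ∀ {S} → Connected (G [ S ]) → Conn S
  connected⇒conn (root , walk) = root , λ x y x∈S y∈S →
    gmap proj₁ (λ {u} {v} u∼v → proj₂ u , proj₂ v , u∼v) (walk (x , x∈S) (y , y∈S))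

  splitDominated⇒ : ∀ {S} → SplitDominated S →
    ∃ λ D → Dominating (G [ S ]) D × Connected ((G [ S ]) [ D ]) × Split ((G [ S ]) [ D ])
  splitDominated⇒ {S} (D , cds , split) = D ∘ proj₁ , dom , (vertex (proj₁ conn) , λ where
      ((x , x∈S) , x∈D) ((y , y∈S) , y∈D) → lift x∈S x∈D y∈S y∈D (proj₂ conn x y x∈D y∈D)) ,
    K ∘ proj₁ ∘ proj₁ ,
    (λ { ((x , x∈S) , x∈D) ((y , y∈S) , y∈D) x∈K y∈K x≢y →
         clique x∈D y∈D x∈K y∈K λ { refl → x≢y (same x∈S y∈S x∈D y∈D) } }) ,
    (λ (_ , x∈D) (_ , y∈D) → stable x∈D y∈D)
    where
    open CDS cds
    open SplitOn split

    same : ∀ {x} (p q : x ∈ S) (p′ q′ : x ∈ D) → ((x , p) , p′) ≡ ((x , q) , q′)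
    same p q p′ q′ with T-irrelevant p q | T-irrelevant p′ q′
    ... | refl | refl = refl

    vertex : (∃ λ x → x ∈ D) → ∃ λ v → v ∈ (D ∘ proj₁)
    vertex (x , x∈D) = (x , D⊆S x x∈D) , x∈D

    dom : Dominating (G [ S ]) (D ∘ proj₁)
    dom (x , x∈S) x∉D with dominates x x∈S
    ... | inj₁ x∈D              = contradiction x∈D x∉D
    ... | inj₂ (d , d∈D , x∼d) = (d , D⊆S d d∈D) , d∈D , x∼d

    lift : ∀ {x y} (p : x ∈ S) (p′ : x ∈ D) (q : y ∈ S) (q′ : y ∈ D) → Walk D x y →
           Star (Graph._∼_ ((G [ S ]) [ D ∘ proj₁ ])) ((x , p) , p′) ((y , q) , q′)
    lift p p′ q q′ ε rewrite T-irrelevant p q | T-irrelevant p′ q′ = ε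
    lift p p′ q q′ ((_ , z∈D , x∼z) ◅ w) = x∼z ◅ lift (D⊆S _ z∈D) z∈D q q′ w

theorem3p1 : ∀ (n : ℕ) (G : Graph (Fin n)) →
    (∀ (S : VertexSet (Fin n)) → Connected (G [ S ]) →
    ∃ λ D → Dominating (G [ S ]) D ×
    Connected ((G [ S ]) [ D ]) × Split ((G [ S ]) [ D ]))
    ⇔ (𝓒 -free G)
theorem3p1 n G = mk⇔
  -- A copy of a forbidden graph is connected, so it would receive a connected split dominating set,
  -- which is carried over to the forbidden graph by the isomorphism.
  (λ dominated → All.zipWith (λ {(_ , H)} (connH , undominated) (S , iso) →
      undominated (splitCDS-≅ G S H iso (dominated S (connected-≅ G S H iso connH))))
    (𝓒-connected , 𝓒-undominated))
  (λ free S conn → splitDominated⇒ G (Main.conn⇒splitDominated G free S (connected⇒conn G conn)))
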